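{- Let $K \subsetneq L$ be a field extension with at least one proper nontrivial finite-dimensional intermediate field (i.e. a field $F$ with $K\subsetneq F\subsetneq L$ and $[F:K]<\infty$). Let $\ell$ and $n$ be integers such that $\ell\geq 0$ and $n_0(K,L) \leq n < [L:K]$. Then there exist $n$-dimensional $K$-subspaces $A,B \subseteq L$ with $1 \notin B$ and $\delta(A,B)>\ell$ if and only if there exists an intermediate field $K \subsetneq F \subsetneq L$ with $[F:K] \leq n$ and $[F:K] \nmid (n+j)$ for all $j\in [\ell+1]$.
   Context: Fields are commutative. All dimensions are over $K$. $[k]=\{1,\dots,k\}$ for a positive integer $k$, and $\langle X\rangle$ denotes the $K$-span of a set $X$. The degree $[L:K]$ may be infinite, in which case $n<[L:K]$ holds for every integer $n$. Definition ($n_0$). $n_0(K,L)=\min_F [F:K]$, where the minimum is over all intermediate fields $K\subsetneq F\subseteq L$ with $[F:K]<\infty$. Definition (partial matching of bases). Let $A,B$ be $n$-dimensional $K$-subspaces of $L$, $n\ge 1$, and $0\le d\le n$ an integer. An ordered basis $\mathcal{A}=\{a_1,\dots,a_n\}$ of $A$ is partially matched to an ordered basis $\mathcal{B}=\{b_1,\dots,b_n\}$ of $B$ with defect $d$ if there exists $P\subseteq[n]$ with $|P|=n-d$ such that $$a_i^{ -1}A\cap B\subseteq \langle b_1,\dots,b_{i-1},b_{i+1},\dots,b_n\rangle\quad\text{for each } i\in P.$$ Definition (partial matching of subspaces). $A$ is partially matched to $B$ with defect $d$ if for every ordered basis $\mathcal{A}$ of $A$ there exists an ordered basis $\mathcal{B}$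 of $B$ such that $\mathcal{A}$ is partially matched to $\mathcal{B}$ with defect $d$. Definition (deficiency). For $n$-dimensional $A,B$ with $0<n<\infty$ and $1\notin B$, $\delta(A,B)$ is the least nonnegative integer $d$ for which $A$ is partially matched to $B$ with defect $d$. -}

module Defs where

open import Level using (Level; _⊔_; suc)
open import Algebra.Bundles using (CommutativeRing)
open import Data.Nat.Base as ℕ using (ℕ; _∸_)
open import Data.Fin.Base using (Fin)
import Data.Fin.Subset as FinSubset
open import Data.Product.Base using (_×_; ∃; ∃-syntax; Σ-syntax)
open import Data.Vec.Functional using (Vector)
open import Relation.Binary.Definitions using (_Respects_)
open import Relation.Binary.PropositionalEquality.Core using (_≡_; _≢_)
open import Relation.Nullary.Negation.Core using (¬_)
open import Relation.Unary using (Pred; _∈_; _⊆_; _⊂_; _≐_; _∩_; U)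
import Algebra.Definitions.RawMonoid as RawMonoid

-- Classical fields.  The inverse is a total operation; its value at 0# is
-- unconstrained (and so is its congruence there).
record Field (c r : Level) : Set (suc (c ⊔ r)) where
  infix 8 _⁻¹
  field
    commutativeRing : CommutativeRing c r
  open CommutativeRing commutativeRing public
  field
    0≉1        : ¬ (0# ≈ 1#)
    _⁻¹        : Carrier → Carrier
    *-inverseʳ : ∀ x → ¬ (x ≈ 0#) → x * x ⁻¹ ≈ 1#

IsLeast : ∀ {p} → Pred ℕ p → Pred ℕ p
IsLeast P d = d ∈ P × (∀ e → e ∈ P → d ℕ.≤ e)

-- A field extension K ⊆ L is a field L together with a subfield K of L, and
-- subsets of L (subfields, K-subspaces, ...) are predicates on its carrier;
-- L itself, viewed as a subset, is U.
module Extension {c r : Level} (L : Field c r) where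

  open Field L
  open RawMonoid +-rawMonoid using (sum)

  Subset : Set (suc (c ⊔ r))
  Subset = Pred Carrier (c ⊔ r)

  record IsSubfield (F : Subset) : Set (c ⊔ r) where
    field
      resp       : F Respects _≈_
      0-closed   : 0# ∈ F
      1-closed   : 1# ∈ F
      +-closed   : ∀ {x y} → x ∈ F → y ∈ F → x + y ∈ F
      neg-closed : ∀ {x} → x ∈ F → - x ∈ F
      *-closed   : ∀ {x y} → x ∈ F → y ∈ F → x * y ∈ F
      ⁻¹-closed  : ∀ {x} → ¬ (x ≈ 0#) → x ∈ F → x ⁻¹ ∈ F

  record IsSubspace (K V : Subset) : Set (c ⊔ r) where
    field
      resp     : V Respects _≈_
      0-closed : 0# ∈ V
      +-closed : ∀ {x y} → x ∈ V → y ∈ V → x + y ∈ V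
      ·-closed : ∀ {k x} → k ∈ K → x ∈ V → k * x ∈ V

  -- ⟨X⟩: all finite K-linear combinations of elements of X.
  Span : ∀ {p} → Subset → Pred Carrier p → Pred Carrier (c ⊔ r ⊔ p)
  Span K X x =
    ∃[ m ] Σ[ k ∈ Vector Carrier m ] Σ[ v ∈ Vector Carrier m ]
      (∀ i → k i ∈ K) × (∀ i → v i ∈ X) × x ≈ sum (λ i → k i * v i)

  Range : ∀ {n} → Vector Carrier n → Pred Carrier r
  Range b x = ∃[ j ] x ≈ b j

  -- {b₁,…,bᵢ₋₁,bᵢ₊₁,…,bₙ}
  RangeOmitting : ∀ {n} → Vector Carrier n → Fin n → Pred Carrier r
  RangeOmitting b i x = ∃[ j ] j ≢ i × x ≈ b j

  LinearlyIndependent : ∀ {n} → Subset → Vector Carrier n → Set (c ⊔ r)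
  LinearlyIndependent {n} K b =
    (k : Vector Carrier n) → (∀ i → k i ∈ K) →
    sum (λ i → k i * b i) ≈ 0# → ∀ i → k i ≈ 0#

  IsBasis : ∀ {p n} → Subset → Pred Carrier p → Vector Carrier n → Set (c ⊔ r ⊔ p)
  IsBasis K V b = LinearlyIndependent K b × Span K (Range b) ≐ V

  HasDimension : ∀ {p} → Subset → Pred Carrier p → ℕ → Set (c ⊔ r ⊔ p)
  HasDimension K V n = Σ[ b ∈ Vector Carrier n ] IsBasis K V b

  -- n < [L : K]; this holds for every n when [L : K] is infinite.
  _<[L:_] : ℕ → Subset → Set (c ⊔ r)
  n <[L: K ] = ∀ d → HasDimension K U d → n ℕ.< d

  Is-n₀ : Subset → ℕ → Set (suc (c ⊔ r))
  Is-n₀ K = IsLeast λ d →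
    Σ[ F ∈ Subset ] IsSubfield F × K ⊂ F × HasDimension K F d

  infixr 7 _·_
  _·_ : ∀ {p} → Carrier → Pred Carrier p → Pred Carrier (c ⊔ r ⊔ p)
  (x · V) y = ∃[ v ] v ∈ V × y ≈ x * v

  -- The ordered bases a of A and b of B are partially matched with defect d.
  BasesPartiallyMatched : ∀ {n} → (K A B : Subset) →
    (a b : Vector Carrier n) → ℕ → Set (c ⊔ r)
  BasesPartiallyMatched {n} K A B a b d =
    Σ[ P ∈ FinSubset.Subset n ] FinSubset.∣ P ∣ ≡ n ∸ d ×
      (∀ i → i FinSubset.∈ P →
        ((a i ⁻¹) · A) ∩ B ⊆ Span K (RangeOmitting b i))

  PartiallyMatched : ℕ → (K A B : Subset) → ℕ → Set (c ⊔ r)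
  PartiallyMatched n K A B d =
    d ℕ.≤ n ×
    ((a : Vector Carrier n) → IsBasis K A a →
     Σ[ b ∈ Vector Carrier n ] IsBasis K B b × BasesPartiallyMatched K A B a b d)

  -- δ(A,B) = d, for A and B of dimension n.
  IsDeficiency : ℕ → (K A B : Subset) → ℕ → Set (c ⊔ r)
  IsDeficiency n K A B = IsLeast (PartiallyMatched n K A B)

module Submission where

-- By Rado's theorem for subspaces, A is not partially matched to B with defect ℓ iff some
-- a₁,…,aₛ from a basis of A satisfy s + dim C > n + ℓ for C = ⋂ aᵢ⁻¹A ∩ B.
-- (⇒) With S = ⟨a₁,…,aₛ⟩ and T = C ⊕ ⟨1⟩, where 1 ∉ B gives the extra dimension, ST ⊆ A.
-- Dyson's transform yields an intermediate field H and an H-subspace V ⊆ A with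
-- dim V + [H:K] ≥ dim S + dim T ≥ n + ℓ + 2.  As [H:K] divides dim V ≤ n, no n + j with
-- 1 ≤ j ≤ ℓ + 1 is a multiple of [H:K].
-- (⇐) Let A contain an F-subspace V with dim V the largest multiple of [F:K] up to n, and let
-- B contain a hyperplane C of F with 1 ∉ B.  As FV ⊆ A, the a ∈ V violate Rado's condition.

-- Rado's theorem enters through duality. A basis b of B matches a on P exactly when, for each i in
-- P, the dual functional of bᵢ vanishes on aᵢ⁻¹A ∩ B. One therefore seeks linearly independent
-- functionals, one from each annihilator of aᵢ⁻¹A ∩ B, with at most ℓ indices left out. The
-- annihilators indexed by a set of size s span a space of dimension n - dim C, which turns Rado's
-- rank condition into the inequality on s + dim C. The proof never forms the dual space: it works
-- inside B with the kernels of the functionals. A theorem of Kneser type would describe the product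
-- ST itself. Here an H-stable subspace anywhere inside A is enough, and the transforms produce one
-- in every extension, with no separability assumption.

open import Defs
open import Level using (_⊔_; suc; Lift; lift)
open import Axiom.ExcludedMiddle using (ExcludedMiddle)
open import Algebra.Bundles using (CommutativeRing)
import Algebra.Properties.CommutativeSemigroup as CommutativeSemigroup
open import Algebra.Solver.Ring.AlmostCommutativeRing
  using (fromCommutativeRing; _-Raw-AlmostCommutative⟶_)
open import Data.Bool.Base using (true; false)
open import Data.Empty using (⊥-elim)
open import Data.Fin.Base as Fin using (Fin; zero; punchIn; punchOut)
open import Data.Fin.Properties using (punchInᵢ≢i; punchIn-punchOut; _≟_)
open import Data.Fin.Subset as FinSubset using (inside; outside; ∣_∣)
import Data.Fin.Subset.Properties as FinSubset
open import Data.Integer.Base as ℤ using (ℤ; +_; -[1+_]; _⊖_)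
import Data.Integer.Properties as ℤ
open import Data.Maybe.Base using (just; nothing)
open import Data.Nat.Base as ℕ using (ℕ; zero; _≤_; _<_; s≤s; z≤n)
open import Data.Nat.Divisibility as ℕ using (_∣_)
open import Data.Nat.DivMod using (_/_; _%_; m≡m%n+[m/n]*n; m%n<n)
import Data.Nat.Properties as ℕ
open import Data.Nat.Tactic.RingSolver using (solve-∀)
open import Data.Product.Base using (_×_; _,_; proj₁; proj₂; ∃; ∃-syntax; Σ-syntax)
open import Data.Sum.Base using (_⊎_; inj₁; inj₂; [_,_]′)
open import Data.Unit.Base using (⊤)
open import Data.Vec.Base using ([]; _∷_; here; there)
open import Data.Vec.Functional as Vector using (Vector; head; tail)
open import Function.Base using (_∘_; id)
open import Function.Bundles using (_⇔_; mk⇔)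
open import Relation.Binary.Definitions using (WeaklyDecidable)
open import Relation.Binary.PropositionalEquality.Core as ≡ using (_≡_; _≢_)
open import Relation.Nullary.Decidable.Core using (Dec; yes; no)
open import Relation.Nullary.Negation.Core using (¬_; contradiction)
open import Relation.Unary using (Pred; _∈_; _∉_; _⊆_; _⊂_; _≐_; _∩_; U)

-- The ring solver with integer coefficients, which lets it cancel x - x.
module IntegerRingSolver {c r} (R : CommutativeRing c r) where
  open CommutativeRing R
  open import Algebra.Properties.Semiring.Mult semiring
    using (×-homo-+; ×1-homo-*) renaming (_×_ to infixr 8 _⊗_)
  open import Algebra.Properties.Ring ring
    using (-0#≈0#; -‿involutive; -‿distribˡ-*; -‿distribʳ-*)
  open import Algebra.Properties.AbelianGroup +-abelianGroup using (⁻¹-∙-comm)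
  open import Relation.Binary.Reasoning.Setoid setoid

  ⟦_⟧ : ℤ → Carrier
  ⟦ + n ⟧      = n ⊗ 1#
  ⟦ -[1+ n ] ⟧ = - (ℕ.suc n ⊗ 1#)

  neg-homo : ∀ i → ⟦ ℤ.- i ⟧ ≈ - ⟦ i ⟧
  neg-homo (+ zero)      = sym -0#≈0#
  neg-homo (+ ℕ.suc n)   = refl
  neg-homo -[1+ n ]      = sym (-‿involutive _)

  shift-difference : ∀ x y z → (z + x) - (z + y) ≈ x - y
  shift-difference x y z = begin
    (z + x) - (z + y)      ≈⟨ +-cong (+-comm z x) (sym (⁻¹-∙-comm z y)) ⟩
    (x + z) + (- z - y)    ≈⟨ +-assoc x z _ ⟩
    x + (z + (- z - y))    ≈⟨ +-congˡ (sym (+-assoc z (- z) (- y))) ⟩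
    x + ((z - z) - y)      ≈⟨ +-congˡ (+-congʳ (-‿inverseʳ z)) ⟩
    x + (0# - y)           ≈⟨ +-congˡ (+-identityˡ (- y)) ⟩
    x - y                  ∎

  ⊖-homo : ∀ m n → ⟦ m ⊖ n ⟧ ≈ m ⊗ 1# - n ⊗ 1#
  ⊖-homo m zero = sym (trans (+-congˡ -0#≈0#) (+-identityʳ _))
  ⊖-homo zero (ℕ.suc n) = sym (+-identityˡ _)
  ⊖-homo (ℕ.suc m) (ℕ.suc n) = begin
    ⟦ ℕ.suc m ⊖ ℕ.suc n ⟧            ≡⟨ ≡.cong ⟦_⟧ (ℤ.[1+m]⊖[1+n]≡m⊖n m n) ⟩
    ⟦ m ⊖ n ⟧                        ≈⟨ ⊖-homo m n ⟩
    m ⊗ 1# - n ⊗ 1#                  ≈⟨ sym (shift-difference _ _ _) ⟩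
    ℕ.suc m ⊗ 1# - ℕ.suc n ⊗ 1#      ∎

  +-homo : ∀ i j → ⟦ i ℤ.+ j ⟧ ≈ ⟦ i ⟧ + ⟦ j ⟧
  +-homo (+ m) (+ n) = ×-homo-+ 1# m n
  +-homo (+ m) -[1+ n ] = ⊖-homo m (ℕ.suc n)
  +-homo -[1+ m ] (+ n) = trans (⊖-homo n (ℕ.suc m)) (+-comm _ _)
  +-homo -[1+ m ] -[1+ n ] = begin
    - (ℕ.suc (ℕ.suc (m ℕ.+ n)) ⊗ 1#)         ≡⟨ ≡.cong (λ k → - (k ⊗ 1#)) (≡.sym (ℕ.+-suc (ℕ.suc m) n)) ⟩
    - ((ℕ.suc m ℕ.+ ℕ.suc n) ⊗ 1#)           ≈⟨ -‿cong (×-homo-+ 1# (ℕ.suc m) (ℕ.suc n)) ⟩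
    - (ℕ.suc m ⊗ 1# + ℕ.suc n ⊗ 1#)          ≈⟨ sym (⁻¹-∙-comm _ _) ⟩
    - (ℕ.suc m ⊗ 1#) - ℕ.suc n ⊗ 1#          ∎

  pos-*-homo : ∀ m j → ⟦ + m ℤ.* j ⟧ ≈ (m ⊗ 1#) * ⟦ j ⟧
  pos-*-homo m (+ n) = begin
    ⟦ + m ℤ.* + n ⟧          ≡⟨ ≡.cong ⟦_⟧ (≡.sym (ℤ.pos-* m n)) ⟩
    (m ℕ.* n) ⊗ 1#           ≈⟨ ×1-homo-* m n ⟩
    (m ⊗ 1#) * (n ⊗ 1#)      ∎
  pos-*-homo m -[1+ n ] = begin
    ⟦ + m ℤ.* -[1+ n ] ⟧             ≡⟨ ≡.cong ⟦_⟧ (≡.sym (ℤ.neg-distribʳ-* (+ m) (+ ℕ.suc n))) ⟩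
    ⟦ ℤ.- (+ m ℤ.* + ℕ.suc n) ⟧      ≈⟨ neg-homo (+ m ℤ.* + ℕ.suc n) ⟩
    - ⟦ + m ℤ.* + ℕ.suc n ⟧          ≈⟨ -‿cong (pos-*-homo m (+ ℕ.suc n)) ⟩
    - ((m ⊗ 1#) * (ℕ.suc n ⊗ 1#))    ≈⟨ -‿distribʳ-* _ _ ⟩
    (m ⊗ 1#) * - (ℕ.suc n ⊗ 1#)      ∎

  *-homo : ∀ i j → ⟦ i ℤ.* j ⟧ ≈ ⟦ i ⟧ * ⟦ j ⟧
  *-homo (+ m) j = pos-*-homo m j
  *-homo -[1+ m ] j = begin
    ⟦ -[1+ m ] ℤ.* j ⟧               ≡⟨ ≡.cong ⟦_⟧ (≡.sym (ℤ.neg-distribˡ-* (+ ℕ.suc m) j)) ⟩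
    ⟦ ℤ.- (+ ℕ.suc m ℤ.* j) ⟧        ≈⟨ neg-homo (+ ℕ.suc m ℤ.* j) ⟩
    - ⟦ + ℕ.suc m ℤ.* j ⟧            ≈⟨ -‿cong (pos-*-homo (ℕ.suc m) j) ⟩
    - ((ℕ.suc m ⊗ 1#) * ⟦ j ⟧)       ≈⟨ -‿distribˡ-* _ _ ⟩
    - (ℕ.suc m ⊗ 1#) * ⟦ j ⟧         ∎

  homomorphism : ℤ.+-*-rawRing -Raw-AlmostCommutative⟶ fromCommutativeRing R
  homomorphism = record
    { ⟦_⟧    = ⟦_⟧
    ; +-homo = +-homo
    ; *-homo = *-homo
    ; -‿homo = neg-homo
    ; 0-homo = refl
    ; 1-homo = +-identityʳ 1#
    }

  coefficient-≟ : WeaklyDecidable λ i j → ⟦ i ⟧ ≈ ⟦ j ⟧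
  coefficient-≟ i j with i ℤ.≟ j
  ... | yes i≡j = just (reflexive (≡.cong ⟦_⟧ i≡j))
  ... | no  _   = nothing

  open import Algebra.Solver.Ring ℤ.+-*-rawRing (fromCommutativeRing R)
    homomorphism coefficient-≟ public
    using (solve; _:=_; _:+_; _:*_; _:-_; :-_; con)

-- Least witnesses, sizes of finite subsets, gaps between multiples

least : ∀ {p} → ExcludedMiddle p → {P : Pred ℕ p} → ∃ P → ∃ (IsLeast P)
least lem {P} (n , Pn) = descend n n ℕ.≤-refl Pn
  where
  descend : ∀ fuel m → m ≤ fuel → P m → ∃ (IsLeast P)
  descend fuel m m≤fuel Pm with lem {∃[ k ] k < m × P k}
  descend fuel m m≤fuel Pm | no none =
    m , Pm , λ k Pk → ℕ.≮⇒≥ λ k<m → none (k , k<m , Pk)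
  descend zero .zero z≤n Pm | yes (k , () , Pk)
  descend (ℕ.suc fuel) m m≤fuel Pm | yes (k , k<m , Pk) =
    descend fuel k (ℕ.s≤s⁻¹ (ℕ.<-≤-trans k<m m≤fuel)) Pk

∣p∪q∣+∣p∩q∣ : ∀ {n} (p q : FinSubset.Subset n) →
  ∣ p FinSubset.∪ q ∣ ℕ.+ ∣ p FinSubset.∩ q ∣ ≡ ∣ p ∣ ℕ.+ ∣ q ∣
∣p∪q∣+∣p∩q∣ [] [] = ≡.refl
∣p∪q∣+∣p∩q∣ (outside ∷ p) (outside ∷ q) = ∣p∪q∣+∣p∩q∣ p q
∣p∪q∣+∣p∩q∣ (outside ∷ p) (inside ∷ q) =
  ≡.trans (≡.cong ℕ.suc (∣p∪q∣+∣p∩q∣ p q)) (≡.sym (ℕ.+-suc ∣ p ∣ ∣ q ∣))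
∣p∪q∣+∣p∩q∣ (inside ∷ p) (outside ∷ q) = ≡.cong ℕ.suc (∣p∪q∣+∣p∩q∣ p q)
∣p∪q∣+∣p∩q∣ (inside ∷ p) (inside ∷ q) = ≡.cong ℕ.suc
  (≡.trans (ℕ.+-suc _ _) (≡.trans (≡.cong ℕ.suc (∣p∪q∣+∣p∩q∣ p q)) (≡.sym (ℕ.+-suc ∣ p ∣ ∣ q ∣))))

0∈p⇒inside : ∀ {n s} {p : FinSubset.Subset n} → zero FinSubset.∈ (s ∷ p) → s ≡ inside
0∈p⇒inside here = ≡.refl

subset-of-size : ∀ {n} (p : FinSubset.Subset n) m → m ≤ ∣ p ∣ →
  ∃[ q ] q FinSubset.⊆ p × ∣ q ∣ ≡ m
subset-of-size [] zero z≤n = [] , id , ≡.refl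
subset-of-size (outside ∷ p) m m≤ =
  let q , q⊆p , ∣q∣≡m = subset-of-size p m m≤ in outside ∷ q , FinSubset.s⊆s q⊆p , ∣q∣≡m
subset-of-size (inside ∷ p) zero m≤ =
  let q , q⊆p , ∣q∣≡0 = subset-of-size p zero z≤n in outside ∷ q , FinSubset.out⊆ q⊆p , ∣q∣≡0
subset-of-size (inside ∷ p) (ℕ.suc m) m≤ =
  let q , q⊆p , ∣q∣≡m = subset-of-size p m (ℕ.s≤s⁻¹ m≤)
  in inside ∷ q , FinSubset.s⊆s q⊆p , ≡.cong ℕ.suc ∣q∣≡m

-- A multiple n + j would exceed the multiple v by a positive multiple of h. But j ≤ ℓ + 1 keeps n +
-- j strictly below v + h.
no-multiple-between : ∀ {h v n ℓ} → 0 < h → h ∣ v → v ≤ n → n ℕ.+ ℓ ℕ.+ 2 ≤ v ℕ.+ h →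
  ∀ j → 1 ≤ j → j ≤ ℓ ℕ.+ 1 → ¬ (h ∣ (n ℕ.+ j))
no-multiple-between {h} {v} {n} {ℓ} 0<h h∣v v≤n n+ℓ+2≤v+h j 1≤j j≤ℓ+1 h∣n+j =
  ℕ.<⇒≱ g<h (ℕ.∣⇒≤ {{ℕ.>-nonZero 0<g}} (ℕ.∣m+n∣m⇒∣n (≡.subst (h ∣_) (≡.sym v+g≡n+j) h∣n+j) h∣v))
  where
  open ℕ.≤-Reasoning
  v<n+j : v < n ℕ.+ j
  v<n+j = begin-strict
    v          ≤⟨ v≤n ⟩
    n          <⟨ ℕ.m<m+n n 1≤j ⟩
    n ℕ.+ j    ∎
  g = n ℕ.+ j ℕ.∸ v
  v+g≡n+j : v ℕ.+ g ≡ n ℕ.+ j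
  v+g≡n+j = ℕ.m+[n∸m]≡n (ℕ.<⇒≤ v<n+j)
  0<g : 0 < g
  0<g = ℕ.m<n⇒0<n∸m v<n+j
  g<h : g < h
  g<h = ℕ.+-cancelˡ-< v g h (begin-strict
    v ℕ.+ g                ≡⟨ v+g≡n+j ⟩
    n ℕ.+ j                ≤⟨ ℕ.+-monoʳ-≤ n j≤ℓ+1 ⟩
    n ℕ.+ (ℓ ℕ.+ 1)        <⟨ ℕ.+-monoʳ-< n (ℕ.+-monoʳ-< ℓ (s≤s (s≤s z≤n))) ⟩
    n ℕ.+ (ℓ ℕ.+ 2)        ≡⟨ ≡.sym (ℕ.+-assoc n ℓ 2) ⟩
    n ℕ.+ ℓ ℕ.+ 2          ≤⟨ n+ℓ+2≤v+h ⟩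
    v ℕ.+ h                ∎)

-- The multiple (q + 1)d is itself of the form n + j with j ≥ 1, so this j must lie beyond the
-- excluded range.
next-multiple-beyond : ∀ {n ℓ d} q → n < q ℕ.* d ℕ.+ d →
  (∀ j → 1 ≤ j → j ≤ ℓ ℕ.+ 1 → ¬ (d ∣ (n ℕ.+ j))) → n ℕ.+ ℓ ℕ.+ 1 < q ℕ.* d ℕ.+ d
next-multiple-beyond {n} {ℓ} {d} q n< no-multiple = begin-strict
  n ℕ.+ ℓ ℕ.+ 1        ≡⟨ ℕ.+-assoc n ℓ 1 ⟩
  n ℕ.+ (ℓ ℕ.+ 1)      <⟨ ℕ.+-monoʳ-< n (ℕ.≰⇒> λ j≤ → no-multiple j (ℕ.m<n⇒0<n∸m n<) j≤ d∣n+j) ⟩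
  n ℕ.+ j              ≡⟨ n+j≡ ⟩
  q ℕ.* d ℕ.+ d        ∎
  where
  open ℕ.≤-Reasoning
  j = q ℕ.* d ℕ.+ d ℕ.∸ n
  n+j≡ : n ℕ.+ j ≡ q ℕ.* d ℕ.+ d
  n+j≡ = ℕ.m+[n∸m]≡n (ℕ.<⇒≤ n<)
  d∣n+j : d ∣ n ℕ.+ j
  d∣n+j = ℕ.divides (ℕ.suc q) (≡.trans n+j≡ (ℕ.+-comm (q ℕ.* d) d))

module Matching {c r} (lem : ExcludedMiddle (suc (c ⊔ r))) (L : Field c r)
  (K : Extension.Subset L) (K-subfield : Extension.IsSubfield L K) where

  open Extension L
  open Field L hiding (zero)
  open IsSubfield
  open IsSubspace
  open IntegerRingSolver commutativeRing using (solve; _:=_; _:+_; _:*_; _:-_; :-_; con)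

  -- Excluded middle is assumed at the level of `Dim`; membership statements live one level lower
  -- and are reached by lifting.
  decide : (P : Set (c ⊔ r)) → Dec P
  decide P with lem {Lift (suc (c ⊔ r)) P}
  ... | yes (lift p) = yes p
  ... | no ¬p        = no λ p → ¬p (lift p)

  ⊆-or-counterexample : (V W : Subset) → V ⊆ W ⊎ ∃[ x ] x ∈ V × x ∉ W
  ⊆-or-counterexample V W with decide (∃[ x ] x ∈ V × x ∉ W)
  ... | yes x∈V∖W = inj₂ x∈V∖W
  ... | no  none  = inj₁ λ {x} x∈V → case-mem x∈V (decide (x ∈ W))
    where
    case-mem : ∀ {x} → x ∈ V → Dec (x ∈ W) → x ∈ W
    case-mem _   (yes x∈W) = x∈W
    case-mem x∈V (no  x∉W) = ⊥-elim (none (_ , x∈V , x∉W))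

  1∈K : 1# ∈ K
  1∈K = 1-closed K-subfield

  quotient-* : ∀ {x} → ¬ (x ≈ 0#) → ∀ y → (y * x ⁻¹) * x ≈ y
  quotient-* {x} x≉0 y = trans
    (solve 3 (λ y x x⁻¹ → (y :* x⁻¹) :* x := y :* (x :* x⁻¹)) refl y x (x ⁻¹))
    (trans (*-congˡ (*-inverseʳ x x≉0)) (*-identityʳ y))

  ⁻¹-cancelˡ : ∀ {x} → ¬ (x ≈ 0#) → ∀ y → x ⁻¹ * (x * y) ≈ y
  ⁻¹-cancelˡ {x} x≉0 y = trans
    (solve 3 (λ x x⁻¹ y → x⁻¹ :* (x :* y) := (y :* x⁻¹) :* x) refl x (x ⁻¹) y)
    (quotient-* x≉0 y)

  ⁻¹-cancelʳ : ∀ {x} → ¬ (x ≈ 0#) → ∀ y → x * (x ⁻¹ * y) ≈ y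
  ⁻¹-cancelʳ {x} x≉0 y = trans
    (solve 3 (λ x x⁻¹ y → x :* (x⁻¹ :* y) := (y :* x⁻¹) :* x) refl x (x ⁻¹) y)
    (quotient-* x≉0 y)

  -- Subspaces

  neg∈ : ∀ {V} → IsSubspace K V → ∀ {x} → x ∈ V → - x ∈ V
  neg∈ V-sub x∈V = resp V-sub
    (trans (solve 2 (λ o x → (:- o) :* x := :- (o :* x)) refl 1# _) (-‿cong (*-identityˡ _)))
    (·-closed V-sub (neg-closed K-subfield 1∈K) x∈V)

  -∈ : ∀ {V} → IsSubspace K V → ∀ {x y} → x ∈ V → y ∈ V → x - y ∈ V
  -∈ V-sub x∈V y∈V = +-closed V-sub x∈V (neg∈ V-sub y∈V)

  ·-cancel : ∀ {V} → IsSubspace K V → ∀ {k x} → ¬ (k ≈ 0#) → k ∈ K → k * x ∈ V → x ∈ V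
  ·-cancel V-sub k≉0 k∈K kx∈V = resp V-sub (⁻¹-cancelˡ k≉0 _)
    (·-closed V-sub (⁻¹-closed K-subfield k≉0 k∈K) kx∈V)

  ·-outside : ∀ {V} → IsSubspace K V → ∀ {k x} → k ∈ K → x ∉ V → k * x ∈ V → k ≈ 0#
  ·-outside V-sub {k} k∈K x∉V kx∈V with decide (Lift c (k ≈ 0#))
  ... | yes (lift k≈0) = k≈0
  ... | no  k≉0        = contradiction (·-cancel V-sub (k≉0 ∘ lift) k∈K kx∈V) x∉V

  ≐-subspace : ∀ {V W : Subset} → V ≐ W → IsSubspace K W → IsSubspace K V
  ≐-subspace (V⊆W , W⊆V) W-sub = record
    { resp     = λ x≈y x∈V → W⊆V (resp W-sub x≈y (V⊆W x∈V))
    ; 0-closed = W⊆V (0-closed W-sub)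
    ; +-closed = λ x∈V y∈V → W⊆V (+-closed W-sub (V⊆W x∈V) (V⊆W y∈V))
    ; ·-closed = λ k∈K x∈V → W⊆V (·-closed W-sub k∈K (V⊆W x∈V))
    }

  ∩-subspace : ∀ {V W} → IsSubspace K V → IsSubspace K W → IsSubspace K (V ∩ W)
  ∩-subspace V-sub W-sub = record
    { resp     = λ x≈y (x∈V , x∈W) → resp V-sub x≈y x∈V , resp W-sub x≈y x∈W
    ; 0-closed = 0-closed V-sub , 0-closed W-sub
    ; +-closed = λ (x∈V , x∈W) (y∈V , y∈W) → +-closed V-sub x∈V y∈V , +-closed W-sub x∈W y∈W
    ; ·-closed = λ k∈K (x∈V , x∈W) → ·-closed V-sub k∈K x∈V , ·-closed W-sub k∈K x∈W
    }

  Zero : Subset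
  Zero x = Lift c (x ≈ 0#)

  Zero-⊆ : ∀ {V} → IsSubspace K V → Zero ⊆ V
  Zero-⊆ V-sub (lift x≈0) = resp V-sub (sym x≈0) (0-closed V-sub)

  Zero-subspace : IsSubspace K Zero
  Zero-subspace = record
    { resp     = λ { x≈y (lift x≈0) → lift (trans (sym x≈y) x≈0) }
    ; 0-closed = lift refl
    ; +-closed = λ { (lift x≈0) (lift y≈0) → lift (trans (+-cong x≈0 y≈0) (+-identityˡ 0#)) }
    ; ·-closed = λ { _ (lift x≈0) → lift (trans (*-congˡ x≈0) (zeroʳ _)) }
    }

  infixl 6 _⊞_ _⊕_
  infixr 4 _,_

  -- Records, so that W and y can be inferred from a proof of x ∈ W ⊞ y.
  record _⊞_ (W : Subset) (y x : Carrier) : Set (c ⊔ r) where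
    constructor _,_
    field
      coefficient : Carrier
      difference  : coefficient ∈ K × x - coefficient * y ∈ W

  -- An ordinary sum of subspaces: `V` and `W` may meet nontrivially.
  record _⊕_ (V W : Subset) (x : Carrier) : Set (c ⊔ r) where
    constructor _,_
    field
      summand    : Carrier
      difference : summand ∈ W × x - summand ∈ V

  ⊕-subspace : ∀ {V W} → IsSubspace K V → IsSubspace K W → IsSubspace K (V ⊕ W)
  ⊕-subspace V-sub W-sub = record
    { resp     = λ x≈y (w , w∈W , d∈V) → w , w∈W , resp V-sub (+-congʳ x≈y) d∈V
    ; 0-closed = 0# , 0-closed W-sub , resp V-sub (sym (-‿inverseʳ 0#)) (0-closed V-sub)
    ; +-closed = λ (w , w∈W , d∈V) (w′ , w′∈W , d′∈V) → w + w′ , +-closed W-sub w∈W w′∈W ,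
        resp V-sub
          (solve 4 (λ x y w w′ → (x :- w) :+ (y :- w′) := (x :+ y) :- (w :+ w′)) refl _ _ w w′)
          (+-closed V-sub d∈V d′∈V)
    ; ·-closed = λ {k} k∈K (w , w∈W , d∈V) → k * w , ·-closed W-sub k∈K w∈W ,
        resp V-sub (solve 3 (λ k x w → k :* (x :- w) := k :* x :- k :* w) refl k _ w)
          (·-closed V-sub k∈K d∈V)
    }

  ⊕-least : ∀ {V W X} → IsSubspace K X → V ⊆ X → W ⊆ X → V ⊕ W ⊆ X
  ⊕-least X-sub V⊆X W⊆X (w , w∈W , d∈V) = resp X-sub
    (solve 2 (λ x w → (x :- w) :+ w := x) refl _ w)
    (+-closed X-sub (V⊆X d∈V) (W⊆X w∈W))

  ⊕-left : ∀ {V W} → IsSubspace K V → IsSubspace K W → V ⊆ V ⊕ W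
  ⊕-left V-sub W-sub x∈V = 0# , 0-closed W-sub , -∈ V-sub x∈V (0-closed V-sub)

  ⊕-right : ∀ {V W} → IsSubspace K V → W ⊆ V ⊕ W
  ⊕-right V-sub {x} x∈W = x , x∈W , resp V-sub (sym (-‿inverseʳ x)) (0-closed V-sub)

  ⊞-subspace : ∀ {W y} → IsSubspace K W → IsSubspace K (W ⊞ y)
  ⊞-subspace {y = y} W-sub = record
    { resp     = λ x≈y (k , k∈K , d∈W) → k , k∈K , resp W-sub (+-congʳ x≈y) d∈W
    ; 0-closed = 0# , 0-closed K-subfield ,
        resp W-sub (solve 1 (λ y → con (+ 0) := con (+ 0) :- con (+ 0) :* y) refl y) (0-closed W-sub)
    ; +-closed = λ (k , k∈K , d∈W) (k′ , k′∈K , d′∈W) → k + k′ , +-closed K-subfield k∈K k′∈K ,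
        resp W-sub
          (solve 5 (λ u v k k′ y → (u :- k :* y) :+ (v :- k′ :* y) := (u :+ v) :- (k :+ k′) :* y)
            refl _ _ k k′ y)
          (+-closed W-sub d∈W d′∈W)
    ; ·-closed = λ {l} l∈K (k , k∈K , d∈W) → l * k , *-closed K-subfield l∈K k∈K ,
        resp W-sub
          (solve 4 (λ l x k y → l :* (x :- k :* y) := l :* x :- (l :* k) :* y) refl l _ k y)
          (·-closed W-sub l∈K d∈W)
    }

  ⊞-extends : ∀ {W y} → IsSubspace K W → W ⊆ W ⊞ y
  ⊞-extends {y = y} W-sub x∈W = 0# , 0-closed K-subfield ,
    resp W-sub (solve 2 (λ x y → x := x :- con (+ 0) :* y) refl _ y) x∈W

  ⊞-contains : ∀ {W y} → IsSubspace K W → y ∈ W ⊞ y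
  ⊞-contains {y = y} W-sub = 1# , 1∈K ,
    resp W-sub (sym (trans (+-congˡ (-‿cong (*-identityˡ y))) (-‿inverseʳ y))) (0-closed W-sub)

  ⊞-least : ∀ {W y V} → IsSubspace K V → W ⊆ V → y ∈ V → W ⊞ y ⊆ V
  ⊞-least {y = y} V-sub W⊆V y∈V (k , k∈K , d∈W) = resp V-sub
    (solve 3 (λ x k y → (x :- k :* y) :+ k :* y := x) refl _ k y)
    (+-closed V-sub (W⊆V d∈W) (·-closed V-sub k∈K y∈V))

  ⊞-mono : ∀ {V W y} → V ⊆ W → V ⊞ y ⊆ W ⊞ y
  ⊞-mono V⊆W (k , k∈K , d∈V) = k , k∈K , V⊆W d∈V

  -- Steinitz exchange: the coefficient of `y` in `x` is nonzero, for otherwise `x` would lie in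
  -- `W`, so the relation can be solved for `y`.
  ⊞-exchange : ∀ {W x y} → IsSubspace K W → x ∈ W ⊞ y → x ∉ W → y ∈ W ⊞ x
  ⊞-exchange {W} {x} {y} W-sub (k , k∈K , d∈W) x∉W =
    k ⁻¹ , ⁻¹-closed K-subfield k≉0 k∈K ,
    ·-cancel W-sub k≉0 k∈K (resp W-sub
      (trans (solve 4 (λ x y k k⁻¹ → :- (x :- k :* y) := k :* (y :- k⁻¹ :* x) :+ ((x :* k⁻¹) :* k :- x))
               refl x y k (k ⁻¹))
        (trans (+-congˡ (trans (+-congʳ (quotient-* k≉0 x)) (-‿inverseʳ x))) (+-identityʳ _)))
      (neg∈ W-sub d∈W))
    where
    k≉0 : ¬ (k ≈ 0#)
    k≉0 k≈0 = x∉W (resp W-sub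
      (trans (+-congˡ (-‿cong (*-congʳ k≈0))) (solve 2 (λ x y → x :- con (+ 0) :* y := x) refl x y))
      d∈W)

  -- An instance of the modular law: the multiple of `y` occurring in `x` lies in `H`, and only the
  -- zero multiple of `y` does.
  ⊞-retract : ∀ {W H x y} → IsSubspace K W → IsSubspace K H → W ⊆ H → y ∉ H → x ∈ H →
    x ∈ W ⊞ y → x ∈ W
  ⊞-retract {x = x} {y} W-sub H-sub W⊆H y∉H x∈H (k , k∈K , d∈W) = resp W-sub
    (trans (+-congˡ (-‿cong (*-congʳ k≈0))) (solve 2 (λ x y → x :- con (+ 0) :* y := x) refl x y))
    d∈W
    where
    k≈0 : k ≈ 0#
    k≈0 = ·-outside H-sub k∈K y∉H (resp H-sub
      (solve 2 (λ x y → x :- (x :- y) := y) refl x (k * y)) (-∈ H-sub x∈H (W⊆H d∈W)))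

  ⊞-split : ∀ {V H y x} → IsSubspace K V → y ∈ V → x ∈ V → x ∈ H ⊞ y → x ∈ (V ∩ H) ⊞ y
  ⊞-split V-sub y∈V x∈V (k , k∈K , d∈H) =
    k , k∈K , -∈ V-sub x∈V (·-closed V-sub k∈K y∈V) , d∈H

  -- Flags and dimension

  -- The inductive substitute for `IsBasis`: a chain of subspaces, each generated by the previous
  -- one and one vector outside it. Inductions on dimension then need no finite sums. Every
  -- constructor describes `V` only up to `≐`, since subsets are predicates.
  data Flag : ∀ {n} → Vector Carrier n → Subset → Set (suc (c ⊔ r)) where
    []    : ∀ {b : Vector Carrier zero} {V} → V ≐ Zero → Flag b V
    step  : ∀ {n} {b : Vector Carrier (ℕ.suc n)} {W V} →
            head b ∉ W → Flag (tail b) W → V ≐ W ⊞ head b → Flag b V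

  Dim : Subset → ℕ → Set (suc (c ⊔ r))
  Dim V n = Σ[ b ∈ Vector Carrier n ] Flag b V

  ≐-refl : ∀ {V : Subset} → V ≐ V
  ≐-refl = id , id

  ≐-trans : ∀ {V W X : Subset} → V ≐ W → W ≐ X → V ≐ X
  ≐-trans (V⊆W , W⊆V) (W⊆X , X⊆W) = W⊆X ∘ V⊆W , W⊆V ∘ X⊆W

  flag-subspace : ∀ {n} {b : Vector Carrier n} {V} → Flag b V → IsSubspace K V
  flag-subspace ([] V≐0)        = ≐-subspace V≐0 Zero-subspace
  flag-subspace (step _ flag V≐) = ≐-subspace V≐ (⊞-subspace (flag-subspace flag))

  dim-subspace : ∀ {V n} → Dim V n → IsSubspace K V
  dim-subspace (_ , flag) = flag-subspace flag

  flag-resp : ∀ {n} {b : Vector Carrier n} {V W} → V ≐ W → Flag b W → Flag b V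
  flag-resp V≐W ([] W≐0)            = [] (≐-trans V≐W W≐0)
  flag-resp V≐W (step y∉X flag W≐X) = step y∉X flag (≐-trans V≐W W≐X)

  dim-resp : ∀ {V W n} → V ≐ W → Dim W n → Dim V n
  dim-resp V≐W (b , flag) = b , flag-resp V≐W flag

  dim-⊞ : ∀ {W y n} → y ∉ W → Dim W n → Dim (W ⊞ y) (ℕ.suc n)
  dim-⊞ {y = y} y∉W (b , flag) = (y Vector.∷ b) , step y∉W flag ≐-refl

  dim-Zero : Dim Zero 0
  dim-Zero = Vector.[] , [] ≐-refl

  -- The second hypothesis says that `V ∩ H` has codimension at most one in `V`. It is phrased
  -- through arbitrary vectors `u` outside `H` because in this form it passes to the smaller spaces
  -- of the flag.
  hyperplane-section : ∀ {V H} n → IsSubspace K H →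
    (∀ {u} → u ∈ V → u ∉ H → V ⊆ H ⊞ u) → ∀ {y} → y ∈ V → y ∉ H →
    Dim V n → ∃[ m ] n ≡ ℕ.suc m × Dim (V ∩ H) m
  hyperplane-section zero H-sub _ y∈V y∉H (_ , [] V≐0) =
    contradiction (Zero-⊆ H-sub (proj₁ V≐0 y∈V)) y∉H
  hyperplane-section {V} {H} (ℕ.suc n) H-sub codim y∈V y∉H (b , step {W = W} z∉W flag V≐)
    with ⊆-or-counterexample W H
  ... | inj₁ W⊆H = n , ≡.refl , dim-resp (V∩H⊆W , λ x∈W → W⊆V x∈W , W⊆H x∈W) (_ , flag)
    where
    W-sub = flag-subspace flag
    W⊆V : W ⊆ V
    W⊆V = proj₂ V≐ ∘ ⊞-extends W-sub
    z∉H : head b ∉ H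
    z∉H z∈H = y∉H (⊞-least H-sub W⊆H z∈H (proj₁ V≐ y∈V))
    V∩H⊆W : V ∩ H ⊆ W
    V∩H⊆W (x∈V , x∈H) = ⊞-retract W-sub H-sub W⊆H z∉H x∈H (proj₁ V≐ x∈V)
  ... | inj₂ (u , u∈W , u∉H)
    with hyperplane-section {W} n H-sub (λ v∈W v∉H → codim (W⊆V v∈W) v∉H ∘ W⊆V) u∈W u∉H (_ , flag)
    where
    W⊆V : W ⊆ V
    W⊆V = proj₂ V≐ ∘ ⊞-extends (flag-subspace flag)
  ... | m , ≡.refl , dim-W∩H with codim (proj₂ V≐ (⊞-extends (flag-subspace flag) u∈W)) u∉H
                                    (proj₂ V≐ (⊞-contains (flag-subspace flag)))
  ... | k , k∈K , h∈H =
    ℕ.suc m , ≡.refl , dim-resp (V∩H⊆ , ⊆V∩H) (dim-⊞ (h∉W ∘ proj₁) dim-W∩H)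
    where
    W-sub = flag-subspace flag
    V-sub = ≐-subspace V≐ (⊞-subspace W-sub)
    W⊆V : W ⊆ V
    W⊆V = proj₂ V≐ ∘ ⊞-extends W-sub
    -- The flag vector is moved into `H` by a multiple of `u ∈ W`, which leaves its class modulo `W`
    -- unchanged.
    h : Carrier
    h = head b - k * u
    h∉W : h ∉ W
    h∉W h∈W = z∉W (resp W-sub (solve 3 (λ z k u → (z :- k :* u) :+ k :* u := z) refl (head b) k u)
      (+-closed W-sub h∈W (·-closed W-sub k∈K u∈W)))
    h∈V : h ∈ V
    h∈V = -∈ V-sub (proj₂ V≐ (⊞-contains W-sub)) (·-closed V-sub k∈K (W⊆V u∈W))
    V∩H⊆ : V ∩ H ⊆ (W ∩ H) ⊞ h
    V∩H⊆ {x} (x∈V , x∈H) with proj₁ V≐ x∈V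
    ... | l , l∈K , d∈W = l , l∈K ,
      resp W-sub
        (solve 5 (λ x l z k u → (x :- l :* z) :+ (l :* k) :* u := x :- l :* (z :- k :* u))
          refl x l (head b) k u)
        (+-closed W-sub d∈W (·-closed W-sub (*-closed K-subfield l∈K k∈K) u∈W)) ,
      -∈ H-sub x∈H (·-closed H-sub l∈K h∈H)
    ⊆V∩H : (W ∩ H) ⊞ h ⊆ V ∩ H
    ⊆V∩H = ⊞-least (∩-subspace V-sub H-sub) (λ (x∈W , x∈H) → W⊆V x∈W , x∈H) (h∈V , h∈H)

  ⊞-hyperplane : ∀ {V H : Subset} {y} → IsSubspace K H → V ⊆ H ⊞ y → ∀ {u} → u ∈ V → u ∉ H → V ⊆ H ⊞ u
  ⊞-hyperplane H-sub V⊆ u∈V u∉H x∈V =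
    ⊞-least (⊞-subspace H-sub) (⊞-extends H-sub) (⊞-exchange H-sub (V⊆ u∈V) u∉H) (V⊆ x∈V)

  -- The hyperplane `W` of the first flag cuts the space described by the second in dimension one
  -- less, so both lengths drop together.
  dim-unique : ∀ {V} m n → Dim V m → Dim V n → m ≡ n
  dim-unique zero zero _ _ = ≡.refl
  dim-unique zero (ℕ.suc n) (_ , [] V≐0) (_ , step y∉W flag V≐) = contradiction
    (Zero-⊆ (flag-subspace flag) (proj₁ V≐0 (proj₂ V≐ (⊞-contains (flag-subspace flag))))) y∉W
  dim-unique {V} (ℕ.suc m) n (b , step {W = W} y∉W flag V≐) dim-V =
    compare (hyperplane-section n W-sub (⊞-hyperplane W-sub (proj₁ V≐))
      (proj₂ V≐ (⊞-contains W-sub)) y∉W dim-V)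
    where
    W-sub = flag-subspace flag
    W≐V∩W : W ≐ (V ∩ W)
    W≐V∩W = (λ x∈W → proj₂ V≐ (⊞-extends W-sub x∈W) , x∈W) , proj₂
    compare : ∃[ n′ ] n ≡ ℕ.suc n′ × Dim (V ∩ W) n′ → ℕ.suc m ≡ n
    compare (n′ , ≡.refl , dim-V∩W) =
      ≡.cong ℕ.suc (dim-unique m n′ (_ , flag) (dim-resp W≐V∩W dim-V∩W))

  -- `J` marks members of the basis `a` that lie in `V`; being independent and dim V in number, they
  -- form a basis of `V`.
  Adapted : ∀ {n} → Subset → Subset → Vector Carrier n → FinSubset.Subset n → Set (suc (c ⊔ r))
  Adapted A V a J = Flag a A × (∀ {i} → i FinSubset.∈ J → a i ∈ V) × Dim V ∣ J ∣

  adapted-basis : ∀ {A V : Subset} n → IsSubspace K V → V ⊆ A → Dim A n →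
    ∃[ a ] ∃[ J ] Adapted {n} A V a J
  adapted-basis zero V-sub V⊆A (a , [] A≐0) =
    a , [] , [] A≐0 , (λ ()) , dim-resp ((λ x∈V → proj₁ A≐0 (V⊆A x∈V)) , Zero-⊆ V-sub) dim-Zero
  adapted-basis {A} {V} (ℕ.suc n) V-sub V⊆A (b , step {W = W} y∉W flag A≐)
    with ⊆-or-counterexample V W
  ... | inj₁ V⊆W with adapted-basis n V-sub V⊆W (_ , flag)
  ...   | a , J , flag-a , a∈V , dim-V =
    head b Vector.∷ a , outside ∷ J , step y∉W flag-a A≐ , (λ { (there i∈J) → a∈V i∈J }) , dim-V
  adapted-basis {A} {V} (ℕ.suc n) V-sub V⊆A (b , step {W = W} y∉W flag A≐)
      | inj₂ (v , v∈V , v∉W)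
    with adapted-basis n (∩-subspace V-sub (flag-subspace flag)) proj₂ (_ , flag)
  ... | a , J , flag-a , a∈V∩W , dim-V∩W =
    v Vector.∷ a , inside ∷ J ,
    step v∉W flag-a (A⊆ , ⊞-least A-sub W⊆A (V⊆A v∈V)) ,
    (λ { here → v∈V ; (there i∈J) → proj₁ (a∈V∩W i∈J) }) ,
    dim-resp
      ((λ x∈V → ⊞-split V-sub v∈V x∈V (A⊆ (V⊆A x∈V))) , ⊞-least V-sub proj₁ v∈V)
      (dim-⊞ (v∉W ∘ proj₂) dim-V∩W)
    where
    W-sub = flag-subspace flag
    A-sub = ≐-subspace A≐ (⊞-subspace W-sub)
    W⊆A : W ⊆ A
    W⊆A = proj₂ A≐ ∘ ⊞-extends W-sub
    A⊆ : A ⊆ W ⊞ v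
    A⊆ = ⊞-hyperplane W-sub (proj₁ A≐) (V⊆A v∈V) v∉W

  subspace-dim : ∀ {A V n} → IsSubspace K V → V ⊆ A → Dim A n → ∃[ m ] m ≤ n × Dim V m
  subspace-dim V-sub V⊆A dim-A with adapted-basis _ V-sub V⊆A dim-A
  ... | _ , J , _ , _ , dim-V = ∣ J ∣ , FinSubset.∣p∣≤n J , dim-V

  dim-mono : ∀ {V W m n} → V ⊆ W → Dim V m → Dim W n → m ≤ n
  dim-mono V⊆W dim-V dim-W with subspace-dim (dim-subspace dim-V) V⊆W dim-W
  ... | m′ , m′≤n , dim-V′ with dim-unique _ _ dim-V dim-V′
  ... | ≡.refl = m′≤n

  dim-strict-mono : ∀ {V W m n x} → V ⊆ W → x ∈ W → x ∉ V → Dim V m → Dim W n → m < n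
  dim-strict-mono V⊆W x∈W x∉V dim-V dim-W =
    dim-mono (⊞-least (dim-subspace dim-W) V⊆W x∈W) (dim-⊞ x∉V dim-V) dim-W

  dim-≤⇒⊇ : ∀ {V W m n} → V ⊆ W → n ≤ m → Dim V m → Dim W n → W ⊆ V
  dim-≤⇒⊇ {V} {W} V⊆W n≤m dim-V dim-W with ⊆-or-counterexample W V
  ... | inj₁ W⊆V = W⊆V
  ... | inj₂ (x , x∈W , x∉V) =
    contradiction n≤m (ℕ.<⇒≱ (dim-strict-mono V⊆W x∈W x∉V dim-V dim-W))

  -- Induction along the flag of `Y`. A new vector lying in `X ⊕ W` can be corrected by `W` to a new
  -- vector of the intersection and leaves the sum unchanged. A new vector outside `X ⊕ W` enlarges
  -- the sum and leaves the intersection unchanged.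
  inclusion-exclusion : ∀ {X Y m} n → Dim X m → Dim Y n →
    ∃[ p ] ∃[ q ] Dim (X ∩ Y) p × Dim (X ⊕ Y) q × p ℕ.+ q ≡ m ℕ.+ n
  inclusion-exclusion {X} {Y} {m} zero dim-X (_ , [] Y≐0) =
    0 , m ,
    dim-resp (proj₁ Y≐0 ∘ proj₂ , λ x∈0 → Zero-⊆ X-sub x∈0 , proj₂ Y≐0 x∈0) dim-Zero ,
    dim-resp (⊕-least X-sub id (Zero-⊆ X-sub ∘ proj₁ Y≐0) , ⊕-left X-sub Y-sub) dim-X ,
    ≡.sym (ℕ.+-identityʳ m)
    where
    X-sub = dim-subspace dim-X
    Y-sub = ≐-subspace Y≐0 Zero-subspace
  inclusion-exclusion {X} {Y} {m} (ℕ.suc n) dim-X (b , step {W = W} z∉W flag Y≐)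
    with inclusion-exclusion n dim-X (_ , flag) | decide (head b ∈ X ⊕ W)
  ... | p , q , dim-X∩W , dim-X⊕W , p+q≡m+n | yes (w , w∈W , x∈X) =
    ℕ.suc p , q ,
    dim-resp (X∩Y⊆ , ⊞-least (∩-subspace X-sub Y-sub) (λ (u∈X , u∈W) → u∈X , W⊆Y u∈W) (x∈X , x∈Y))
      (dim-⊞ (x∉W ∘ proj₂) dim-X∩W) ,
    dim-resp (⊕-least X⊕W-sub (⊕-left X-sub W-sub)
               (⊞-least X⊕W-sub (⊕-right X-sub) (w , w∈W , x∈X) ∘ proj₁ Y≐) ,
              λ (u , u∈W , d) → u , W⊆Y u∈W , d) dim-X⊕W ,
    ≡.trans (≡.cong ℕ.suc p+q≡m+n) (≡.sym (ℕ.+-suc m n))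
    where
    X-sub = dim-subspace dim-X
    W-sub = flag-subspace flag
    Y-sub = ≐-subspace Y≐ (⊞-subspace W-sub)
    X⊕W-sub = ⊕-subspace X-sub W-sub
    W⊆Y : W ⊆ Y
    W⊆Y = proj₂ Y≐ ∘ ⊞-extends W-sub
    x : Carrier
    x = head b - w
    x∈Y : x ∈ Y
    x∈Y = -∈ Y-sub (proj₂ Y≐ (⊞-contains W-sub)) (W⊆Y w∈W)
    x∉W : x ∉ W
    x∉W x∈W = z∉W (resp W-sub (solve 2 (λ z w → (z :- w) :+ w := z) refl (head b) w)
      (+-closed W-sub x∈W w∈W))
    X∩Y⊆ : X ∩ Y ⊆ (X ∩ W) ⊞ x
    X∩Y⊆ (u∈X , u∈Y) = ⊞-split X-sub x∈X u∈X
      (⊞-hyperplane W-sub (proj₁ Y≐) x∈Y x∉W u∈Y)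
  ... | p , q , dim-X∩W , dim-X⊕W , p+q≡m+n | no z∉X⊕W =
    p , ℕ.suc q ,
    dim-resp (X∩Y⊆ , λ (u∈X , u∈W) → u∈X , W⊆Y u∈W) dim-X∩W ,
    dim-resp (⊕-least (⊞-subspace X⊕W-sub)
                (⊞-extends X⊕W-sub ∘ ⊕-left X-sub W-sub)
                (⊞-mono (⊕-right X-sub) ∘ proj₁ Y≐) ,
              ⊞-least (⊕-subspace X-sub Y-sub) (λ (u , u∈W , d) → u , W⊆Y u∈W , d)
                (⊕-right X-sub (proj₂ Y≐ (⊞-contains W-sub))))
      (dim-⊞ z∉X⊕W dim-X⊕W) ,
    ≡.trans (ℕ.+-suc p q) (≡.trans (≡.cong ℕ.suc p+q≡m+n) (≡.sym (ℕ.+-suc m n)))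
    where
    X-sub = dim-subspace dim-X
    W-sub = flag-subspace flag
    Y-sub = ≐-subspace Y≐ (⊞-subspace W-sub)
    X⊕W-sub = ⊕-subspace X-sub W-sub
    W⊆Y : W ⊆ Y
    W⊆Y = proj₂ Y≐ ∘ ⊞-extends W-sub
    X∩Y⊆ : X ∩ Y ⊆ X ∩ W
    X∩Y⊆ {u} (u∈X , u∈Y) with decide (u ∈ W)
    ... | yes u∈W = u∈X , u∈W
    ... | no  u∉W = contradiction
      (⊞-least X⊕W-sub (⊕-right X-sub) (⊕-left X-sub W-sub u∈X)
        (⊞-exchange W-sub (proj₁ Y≐ u∈Y) u∉W)) z∉X⊕W

  -- Dilates of subspaces

  ·-subspace : ∀ {V e} → IsSubspace K V → IsSubspace K (e · V)
  ·-subspace {e = e} V-sub = record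
    { resp     = λ x≈y (v , v∈V , x≈ev) → v , v∈V , trans (sym x≈y) x≈ev
    ; 0-closed = 0# , 0-closed V-sub , sym (zeroʳ e)
    ; +-closed = λ (v , v∈V , x≈ev) (w , w∈V , y≈ew) →
        v + w , +-closed V-sub v∈V w∈V , trans (+-cong x≈ev y≈ew) (sym (distribˡ e v w))
    ; ·-closed = λ {k} k∈K (v , v∈V , x≈ev) → k * v , ·-closed V-sub k∈K v∈V ,
        trans (*-congˡ x≈ev) (solve 3 (λ k e v → k :* (e :* v) := e :* (k :* v)) refl k e v)
    }

  dim-· : ∀ {V n e} → ¬ (e ≈ 0#) → Dim V n → Dim (e · V) n
  dim-· {V} {zero} {e} e≉0 (b , [] V≐0) = b , [] (e·V⊆0 , Zero-⊆ (·-subspace V-sub))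
    where
    V-sub = ≐-subspace V≐0 Zero-subspace
    e·V⊆0 : e · V ⊆ Zero
    e·V⊆0 (v , v∈V , x≈ev) with proj₁ V≐0 v∈V
    ... | lift v≈0 = lift (trans x≈ev (trans (*-congˡ v≈0) (zeroʳ e)))
  dim-· {V} {ℕ.suc n} {e} e≉0 (b , step {W = W} z∉W flag V≐) = dim-resp
    (⊆₁ , ⊞-least (·-subspace V-sub) (λ (w , w∈W , x≈ew) → w , W⊆V w∈W , x≈ew)
      (head b , proj₂ V≐ (⊞-contains W-sub) , refl))
    (dim-⊞ ez∉ (dim-· e≉0 (_ , flag)))
    where
    W-sub = flag-subspace flag
    V-sub = ≐-subspace V≐ (⊞-subspace W-sub)
    W⊆V : W ⊆ V
    W⊆V = proj₂ V≐ ∘ ⊞-extends W-sub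
    ez∉ : e * head b ∉ e · W
    ez∉ (w , w∈W , ez≈ew) = z∉W (resp W-sub 
      (trans (sym (⁻¹-cancelˡ e≉0 w)) (trans (*-congˡ (sym ez≈ew)) (⁻¹-cancelˡ e≉0 (head b)))) w∈W)
    ⊆₁ : e · V ⊆ (e · W) ⊞ (e * head b)
    ⊆₁ (v , v∈V , x≈ev) with proj₁ V≐ v∈V
    ... | k , k∈K , d∈W = k , k∈K , v - k * head b , d∈W ,
      trans (+-congʳ x≈ev)
        (solve 4 (λ e v k z → e :* v :- k :* (e :* z) := e :* (v :- k :* z)) refl e v k (head b))

  -- Bases and flags

  open import Algebra.Definitions.RawMonoid +-rawMonoid using (sum)

  ∷∈K : ∀ {n x} {xs : Vector Carrier n} →
    x ∈ K → (∀ i → xs i ∈ K) → ∀ i → (x Vector.∷ xs) i ∈ K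
  ∷∈K x∈K xs∈K zero        = x∈K
  ∷∈K x∈K xs∈K (Fin.suc i) = xs∈K i

  sum-closed : ∀ {V} → IsSubspace K V → ∀ {m} (k v : Vector Carrier m) →
    (∀ i → k i ∈ K) → (∀ i → v i ∈ V) → sum (λ i → k i * v i) ∈ V
  sum-closed V-sub {zero}    k v k∈K v∈V = 0-closed V-sub
  sum-closed V-sub {ℕ.suc m} k v k∈K v∈V = +-closed V-sub
    (·-closed V-sub (k∈K zero) (v∈V zero))
    (sum-closed V-sub (tail k) (tail v) (k∈K ∘ Fin.suc) (v∈V ∘ Fin.suc))

  Span-least : ∀ {p} {X : Pred Carrier p} {V : Subset} → IsSubspace K V → X ⊆ V → Span K X ⊆ V
  Span-least V-sub X⊆V (m , k , v , k∈K , v∈X , x≈sum) =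
    resp V-sub (sym x≈sum) (sum-closed V-sub k v k∈K (λ i → X⊆V (v∈X i)))

  flag-∈ : ∀ {n} {b : Vector Carrier n} {V} → Flag b V → ∀ i → b i ∈ V
  flag-∈ (step _ flag V≐) zero        = proj₂ V≐ (⊞-contains (flag-subspace flag))
  flag-∈ (step _ flag V≐) (Fin.suc i) = proj₂ V≐ (⊞-extends (flag-subspace flag) (flag-∈ flag i))

  flag-least : ∀ {n} {b : Vector Carrier n} {V X} → IsSubspace K X →
    Flag b V → (∀ i → b i ∈ X) → V ⊆ X
  flag-least X-sub ([] V≐0) b∈X x∈V = Zero-⊆ X-sub (proj₁ V≐0 x∈V)
  flag-least X-sub (step _ flag V≐) b∈X x∈V =
    ⊞-least X-sub (flag-least X-sub flag (b∈X ∘ Fin.suc)) (b∈X zero) (proj₁ V≐ x∈V)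

  Combination : ∀ {n} → Vector Carrier n → Subset
  Combination {n} b x = Σ[ k ∈ Vector Carrier n ] (∀ i → k i ∈ K) × x ≈ sum (λ i → k i * b i)

  combination-⊞ : ∀ {n} (b : Vector Carrier (ℕ.suc n)) →
    Combination b ≐ Combination (tail b) ⊞ head b
  combination-⊞ b =
    (λ (k , k∈K , x≈sum) → k zero , k∈K zero , tail k , k∈K ∘ Fin.suc ,
      trans (+-congʳ x≈sum) (solve 2 (λ s y → (y :+ s) :- y := s) refl _ (k zero * head b))) ,
    λ (k₀ , k₀∈K , k , k∈K , d≈sum) → k₀ Vector.∷ k , ∷∈K k₀∈K k∈K ,
      trans (solve 2 (λ x y → x := y :+ (x :- y)) refl _ (k₀ * head b)) (+-congˡ d≈sum)

  flag-combination : ∀ {n} {b : Vector Carrier n} {V} → Flag b V → V ⊆ Combination b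
  flag-combination ([] V≐0) x∈V with proj₁ V≐0 x∈V
  ... | lift x≈0 = Vector.[] , (λ ()) , x≈0
  flag-combination {b = b} (step _ flag V≐) x∈V =
    proj₂ (combination-⊞ b) (⊞-mono (flag-combination flag) (proj₁ V≐ x∈V))

  flag-independent : ∀ {n} {b : Vector Carrier n} {V} → Flag b V → LinearlyIndependent K b
  flag-independent {b = b} (step {W = W} y∉W flag V≐) k k∈K sum≈0 =
    λ { zero → k₀≈0 ; (Fin.suc i) → flag-independent flag (tail k) (k∈K ∘ Fin.suc) rest≈0 i }
    where
    W-sub = flag-subspace flag
    rest : Carrier
    rest = sum (λ i → tail k i * tail b i)
    k₀≈0 : k zero ≈ 0#
    k₀≈0 = ·-outside W-sub (k∈K zero) y∉W (resp W-sub
      (trans (solve 2 (λ y s → :- s := y :- (y :+ s)) refl (k zero * head b) rest)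
        (trans (+-congˡ (-‿cong sum≈0)) (solve 1 (λ y → y :- con (+ 0) := y) refl _)))
      (neg∈ W-sub (sum-closed W-sub (tail k) (tail b) (k∈K ∘ Fin.suc) (flag-∈ flag))))
    rest≈0 : rest ≈ 0#
    rest≈0 = trans (solve 2 (λ y s → s := con (+ 0) :* y :+ s) refl (head b) rest)
      (trans (+-congʳ (*-congʳ (sym k₀≈0))) sum≈0)

  independent-flag : ∀ {n} (b : Vector Carrier n) → LinearlyIndependent K b →
    Flag b (Combination b)
  independent-flag {zero} b independent =
    [] ((λ (_ , _ , x≈0) → lift x≈0) , λ { (lift x≈0) → Vector.[] , (λ ()) , x≈0 })
  independent-flag {ℕ.suc n} b independent =
    step b₀∉ (independent-flag (tail b) tail-independent) (combination-⊞ b)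
    where
    b₀∉ : head b ∉ Combination (tail b)
    b₀∉ (k , k∈K , b₀≈sum) = 0≉1 (trans
      (sym (trans (-‿cong -1≈0) (solve 0 (:- con (+ 0) := con (+ 0)) refl)))
      (solve 1 (λ o → :- (:- o) := o) refl 1#))
      where
      -1≈0 : - 1# ≈ 0#
      -1≈0 = independent (- 1# Vector.∷ k) (∷∈K (neg-closed K-subfield 1∈K) k∈K)
        (trans (+-congˡ (sym b₀≈sum))
          (trans (solve 2 (λ o y → (:- o) :* y :+ y := y :- o :* y) refl 1# (head b))
            (trans (+-congˡ (-‿cong (*-identityˡ _))) (-‿inverseʳ _)))) zero
    tail-independent : LinearlyIndependent K (tail b)
    tail-independent k k∈K sum≈0 i =
      independent (0# Vector.∷ k) (∷∈K (0-closed K-subfield) k∈K)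
        (trans (+-cong (zeroˡ _) sum≈0) (+-identityˡ 0#)) (Fin.suc i)

  flag⇒basis : ∀ {n} {b : Vector Carrier n} {V} → Flag b V → IsBasis K V b
  flag⇒basis {n} {b} flag = flag-independent flag ,
    Span-least {X = Range b} V-sub (λ (i , x≈bᵢ) → resp V-sub (sym x≈bᵢ) (flag-∈ flag i)) ,
    λ x∈V → let k , k∈K , x≈sum = flag-combination flag x∈V in
      n , k , b , k∈K , (λ i → i , refl) , x≈sum
    where V-sub = flag-subspace flag

  basis⇒flag : ∀ {n} {b : Vector Carrier n} {V} → IsBasis K V b → Flag b V
  basis⇒flag {n} {b} (independent , span⊆V , V⊆span) = flag-resp
    ((λ x∈V → Span-least {X = Range b} (flag-subspace flag)
      (λ (i , x≈bᵢ) → resp (flag-subspace flag) (sym x≈bᵢ) (flag-∈ flag i)) (V⊆span x∈V)) ,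
     λ (k , k∈K , x≈sum) → span⊆V (n , k , b , k∈K , (λ i → i , refl) , x≈sum))
    flag
    where flag = independent-flag b independent

  dim⇒ : ∀ {V n} → Dim V n → HasDimension K V n
  dim⇒ (b , flag) = b , flag⇒basis flag

  dim⇐ : ∀ {V n} → HasDimension K V n → Dim V n
  dim⇐ (b , basis) = b , basis⇒flag basis

  dim-U : ∀ {V n} → Dim V n → (∀ x → x ∈ V) → HasDimension K U n
  dim-U (b , flag) all∈V with flag⇒basis flag
  ... | independent , _ , V⊆span = b , independent , _ , λ {x} _ → V⊆span (all∈V x)

  -- `S` is the span of the marked vectors. It is described by minimality, so that products with `S`
  -- can later be checked on the vectors `a i` alone.
  flag-subset : ∀ {n} {a : Vector Carrier n} {A} → Flag a A → (J : FinSubset.Subset n) →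
    ∃[ S ] S ⊆ A × Dim S ∣ J ∣ ×
      (∀ {X} → IsSubspace K X → (∀ {i} → i FinSubset.∈ J → a i ∈ X) → S ⊆ X)
  flag-subset ([] A≐0) [] = Zero , proj₂ A≐0 , dim-Zero , λ X-sub _ → Zero-⊆ X-sub
  flag-subset (step y∉W flag A≐) (outside ∷ J) with flag-subset flag J
  ... | S , S⊆W , dim-S , S-least =
    S , (λ x∈S → proj₂ A≐ (⊞-extends (flag-subspace flag) (S⊆W x∈S))) , dim-S ,
    λ X-sub a∈X → S-least X-sub (a∈X ∘ there)
  flag-subset {a = a} (step y∉W flag A≐) (inside ∷ J) with flag-subset flag J
  ... | S , S⊆W , dim-S , S-least =
    S ⊞ head a , (λ x∈S′ → proj₂ A≐ (⊞-mono S⊆W x∈S′)) , dim-⊞ (y∉W ∘ S⊆W) dim-S ,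
    λ X-sub a∈X → ⊞-least X-sub (S-least X-sub (a∈X ∘ there)) (a∈X here)

  -- Subspaces avoiding a vector

  -- Each new vector is taken outside `W ⊞ b`; by exchange, `b` still misses the enlarged space. The
  -- space to be avoided is one dimension larger than the one being enlarged, which is why `room`
  -- must reach dimension w + j.
  grow : ∀ {W X b w} j → IsSubspace K X → W ⊆ X → b ∉ W → Dim W w →
    (∀ {V v} → Dim V v → v ≤ w ℕ.+ j → ∃[ x ] x ∈ X × x ∉ V) →
    ∃[ H ] W ⊆ H × H ⊆ X × b ∉ H × Dim H (w ℕ.+ j)
  grow {W} {w = w} zero X-sub W⊆X b∉W dim-W room =
    W , id , W⊆X , b∉W , ≡.subst (Dim W) (≡.sym (ℕ.+-identityʳ w)) dim-W
  grow {W} {X} {b} {w} (ℕ.suc j) X-sub W⊆X b∉W dim-W room = enlarge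
    (room (dim-⊞ b∉W dim-W) (≡.subst (ℕ.suc w ≤_) (≡.sym (ℕ.+-suc w j)) (s≤s (ℕ.m≤m+n w j))))
    where
    W-sub = dim-subspace dim-W
    enlarge : ∃[ x ] x ∈ X × x ∉ W ⊞ b →
      ∃[ H ] W ⊆ H × H ⊆ X × b ∉ H × Dim H (w ℕ.+ ℕ.suc j)
    enlarge (x , x∈X , x∉W⊞b) =
      let H , W⊞x⊆H , H⊆X , b∉H , dim-H = grow j X-sub (⊞-least X-sub W⊆X x∈X)
            (λ b∈W⊞x → x∉W⊞b (⊞-exchange W-sub b∈W⊞x b∉W))
            (dim-⊞ (x∉W⊞b ∘ ⊞-extends W-sub) dim-W)
            (λ {_} {v} dim-V v≤ → room dim-V (≡.subst (v ≤_) (≡.sym (ℕ.+-suc w j)) v≤))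
      in H , (W⊞x⊆H ∘ ⊞-extends W-sub) , H⊆X , b∉H ,
         ≡.subst (Dim H) (≡.sym (ℕ.+-suc w j)) dim-H

  hyperplane-avoiding : ∀ {B W b m} → IsSubspace K W → W ⊆ B → b ∈ B → b ∉ W →
    Dim B (ℕ.suc m) → ∃[ H ] W ⊆ H × H ⊆ B × b ∉ H × Dim H m
  hyperplane-avoiding {B} {W} {b} {m} W-sub W⊆B b∈B b∉W dim-B =
    let w , _ , dim-W = subspace-dim W-sub W⊆B dim-B
        j , w+j≡m = ℕ.m≤n⇒∃[o]m+o≡n (ℕ.s≤s⁻¹ (dim-strict-mono W⊆B b∈B b∉W dim-W dim-B))
        H , W⊆H , H⊆B , b∉H , dim-H = grow j (dim-subspace dim-B) W⊆B b∉W dim-W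
          (λ {_} {v} dim-V v≤ → room dim-V (≡.subst (v ≤_) w+j≡m v≤))
    in H , W⊆H , H⊆B , b∉H , ≡.subst (Dim H) w+j≡m dim-H
    where
    room : ∀ {V v} → Dim V v → v ≤ m → ∃[ x ] x ∈ B × x ∉ V
    room {V} dim-V v≤m with ⊆-or-counterexample B V
    ... | inj₁ B⊆V = contradiction (dim-mono B⊆V dim-B dim-V) (ℕ.<⇒≱ (s≤s v≤m))
    ... | inj₂ x   = x

  dim-·⁻ : ∀ {V n e} → ¬ (e ≈ 0#) → IsSubspace K V → Dim (e · V) n → Dim V n
  dim-·⁻ {V} {n} {e} e≉0 V-sub dim-eV = dim-resp
    ((λ {v} v∈V → e * v , (v , v∈V , refl) , sym (⁻¹-cancelˡ e≉0 v)) ,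
     λ (z , (v , v∈V , z≈ev) , x≈e⁻¹z) →
       resp V-sub (sym (trans x≈e⁻¹z (trans (*-congˡ z≈ev) (⁻¹-cancelˡ e≉0 v)))) v∈V)
    (dim-· e⁻¹≉0 dim-eV)
    where
    e⁻¹≉0 : ¬ (e ⁻¹ ≈ 0#)
    e⁻¹≉0 e⁻¹≈0 = 0≉1 (trans (sym (zeroʳ e)) (trans (*-congˡ (sym e⁻¹≈0)) (*-inverseʳ e e≉0)))

  -- Intermediate fields

  Stable : Subset → Subset → Set (c ⊔ r)
  Stable H W = ∀ {h w} → h ∈ H → w ∈ W → h * w ∈ W

  Zero-stable : ∀ {H} → Stable H Zero
  Zero-stable _ (lift w≈0) = lift (trans (*-congˡ w≈0) (zeroʳ _))

  subfield-subspace : ∀ {H} → IsSubfield H → K ⊆ H → IsSubspace K H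
  subfield-subspace H-fld K⊆H = record
    { resp     = resp H-fld
    ; 0-closed = 0-closed H-fld
    ; +-closed = +-closed H-fld
    ; ·-closed = *-closed H-fld ∘ K⊆H
    }

  dim-positive : ∀ {V n x} → x ∈ V → ¬ (x ≈ 0#) → Dim V n → 0 < n
  dim-positive x∈V x≉0 dim-V =
    dim-strict-mono (Zero-⊆ (dim-subspace dim-V)) x∈V (λ { (lift x≈0) → x≉0 x≈0 }) dim-Zero dim-V

  -- The sum is direct: if `x * y` lies in `W` for some nonzero `y ∈ H`, stability under `y ⁻¹` puts
  -- `x` in `W`.
  adjoin-line : ∀ {H W x h m} → IsSubfield H → K ⊆ H → Dim H h →
    Stable H W → Dim W m → x ∉ W →
    Stable H (W ⊕ (x · H)) × Dim (W ⊕ (x · H)) (m ℕ.+ h)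
  adjoin-line {H} {W} {x} {h} {m} H-fld K⊆H dim-H W-stable dim-W x∉W = stable , dim
    where
    W-sub = dim-subspace dim-W
    x≉0 : ¬ (x ≈ 0#)
    x≉0 x≈0 = x∉W (Zero-⊆ W-sub (lift x≈0))
    stable : Stable H (W ⊕ (x · H))
    stable {g} g∈H (_ , (y , y∈H , z≈xy) , d∈W) =
      g * (x * y) , (g * y , *-closed H-fld g∈H y∈H ,
        solve 3 (λ g x y → g :* (x :* y) := x :* (g :* y)) refl g x y) ,
      resp W-sub
        (trans (solve 3 (λ g u z → g :* (u :- z) := g :* u :- g :* z) refl g _ _)
          (+-congˡ (-‿cong (*-congˡ z≈xy))))
        (W-stable g∈H d∈W)
    ∩⊆0 : W ∩ (x · H) ⊆ Zero
    ∩⊆0 (z∈W , y , y∈H , z≈xy) with decide (Lift c (y ≈ 0#))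
    ... | yes (lift y≈0) = lift (trans z≈xy (trans (*-congˡ y≈0) (zeroʳ x)))
    ... | no  y≉0 = contradiction
      (resp W-sub
        (trans (*-congˡ (trans z≈xy (*-comm x y))) (⁻¹-cancelˡ (y≉0 ∘ lift) x))
        (W-stable (⁻¹-closed H-fld (y≉0 ∘ lift) y∈H) z∈W))
      x∉W
    dim : Dim (W ⊕ (x · H)) (m ℕ.+ h)
    dim with inclusion-exclusion _ dim-W (dim-· x≉0 dim-H)
    ... | p , q , dim-∩ , dim-⊕ , p+q≡
      with dim-unique p 0 dim-∩ (dim-resp (∩⊆0 , Zero-⊆ (dim-subspace dim-∩)) dim-Zero)
    ... | ≡.refl = ≡.subst (Dim (W ⊕ (x · H))) p+q≡ dim-⊕

  -- `V` is exhausted by dilates `x · H`, each meeting the stable space built so far only in zero,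
  -- so the dimension grows in steps of `h`. The argument `gap` bounds what is missing and makes the
  -- recursion terminate.
  tower-∣ : ∀ {H V h v} → IsSubfield H → K ⊆ H → Dim H h → Stable H V → Dim V v → h ∣ v
  tower-∣ {H} {V} {h} {v} H-fld K⊆H dim-H V-stable dim-V =
    fill v 0 (Zero-⊆ V-sub) (Zero-stable {H}) dim-Zero ℕ.≤-refl
    where
    V-sub = dim-subspace dim-V
    0<h : 0 < h
    0<h = dim-positive (1-closed H-fld) (0≉1 ∘ sym) dim-H
    fill : ∀ gap q {W} → W ⊆ V → Stable H W → Dim W (q ℕ.* h) → v ≤ q ℕ.* h ℕ.+ gap → h ∣ v
    fill gap q {W} W⊆V W-stable dim-W v≤ with ⊆-or-counterexample V W
    fill gap q {W} W⊆V W-stable dim-W v≤ | inj₁ V⊆W =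
      ℕ.divides q (dim-unique _ _ dim-V (dim-resp (V⊆W , W⊆V) dim-W))
    fill zero q {W} W⊆V W-stable dim-W v≤ | inj₂ (x , x∈V , x∉W) = contradiction
      (≡.subst (v ≤_) (ℕ.+-identityʳ _) v≤) (ℕ.<⇒≱ (dim-strict-mono W⊆V x∈V x∉W dim-W dim-V))
    fill (ℕ.suc gap) q {W} W⊆V W-stable dim-W v≤ | inj₂ (x , x∈V , x∉W)
      with adjoin-line H-fld K⊆H dim-H W-stable dim-W x∉W
    ... | stable , dim-W′ = fill gap (ℕ.suc q) W′⊆V stable
      (≡.subst (Dim (W ⊕ (x · H))) (ℕ.+-comm (q ℕ.* h) h) dim-W′) v≤′
      where
      W′⊆V : W ⊕ (x · H) ⊆ V
      W′⊆V = ⊕-least V-sub W⊆V λ (y , y∈H , z≈xy) →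
        resp V-sub (trans (*-comm y x) (sym z≈xy)) (V-stable y∈H x∈V)
      v≤′ : v ≤ ℕ.suc q ℕ.* h ℕ.+ gap
      v≤′ = begin
        v                              ≤⟨ v≤ ⟩
        q ℕ.* h ℕ.+ ℕ.suc gap          ≡⟨ ℕ.+-suc (q ℕ.* h) gap ⟩
        ℕ.suc (q ℕ.* h) ℕ.+ gap        ≤⟨ ℕ.+-monoˡ-≤ gap (ℕ.+-monoˡ-≤ (q ℕ.* h) 0<h) ⟩
        ℕ.suc q ℕ.* h ℕ.+ gap          ∎
        where open ℕ.≤-Reasoning

  stable-subspace : ∀ {H h} q → IsSubfield H → K ⊆ H → Dim H h →
    (∀ {V v} → Dim V v → v < q ℕ.* h → ∃[ x ] x ∉ V) →
    ∃[ V ] Stable H V × Dim V (q ℕ.* h)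
  stable-subspace {H} zero H-fld K⊆H dim-H room =
    Zero , Zero-stable {H} , dim-Zero
  stable-subspace {H} {h} (ℕ.suc q) H-fld K⊆H dim-H room =
    let V , V-stable , dim-V = stable-subspace q H-fld K⊆H dim-H
          (λ dim-W w< → room dim-W (ℕ.<-≤-trans w< (ℕ.m≤n+m _ h)))
        x , x∉V = room dim-V (ℕ.+-monoˡ-≤ (q ℕ.* h)
          (dim-positive (1-closed H-fld) (0≉1 ∘ sym) dim-H))
        stable , dim-V′ = adjoin-line H-fld K⊆H dim-H V-stable dim-V x∉V
    in V ⊕ (x · H) , stable , ≡.subst (Dim (V ⊕ (x · H))) (ℕ.+-comm (q ℕ.* h) h) dim-V′

  -- Products of subspaces

  -- Here `n` is a lower bound for dim V + [H:K], not the dimension of `A`. The field `0<v` is what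
  -- later turns divisibility of `v` by `h` into h ≤ v.
  record StableSubspace (A : Subset) (n : ℕ) : Set (suc (c ⊔ r)) where
    field
      {H V}      : Subset
      {h v}      : ℕ
      H-subfield : IsSubfield H
      K⊆H        : K ⊆ H
      dim-H      : Dim H h
      V⊆A        : V ⊆ A
      stable     : Stable H V
      dim-V      : Dim V v
      0<v        : 0 < v
      bound      : n ≤ v ℕ.+ h

  -- `H` is the stabilizer of `S`. It contains `T` by hypothesis, which gives t ≤ h, and it is
  -- finite-dimensional because `x₀ · H` lies in `S`.
  stabilizer-bound : ∀ {A S T s t x₀} → Dim S s → Dim T t → x₀ ∈ S → ¬ (x₀ ≈ 0#) → S ⊆ A →
    (∀ {x y} → x ∈ S → y ∈ T → x * y ∈ S) → StableSubspace A (s ℕ.+ t)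
  stabilizer-bound {A} {S} {T} {s} {t} {x₀} dim-S dim-T x₀∈S x₀≉0 S⊆A ST⊆S = record
    { H          = H
    ; V          = S
    ; H-subfield = H-subfield
    ; K⊆H        = K⊆H
    ; dim-H      = proj₂ dim-H
    ; V⊆A        = S⊆A
    ; stable     = λ h∈H w∈S → h∈H _ w∈S
    ; dim-V      = dim-S
    ; 0<v        = dim-positive x₀∈S x₀≉0 dim-S
    ; bound      = ℕ.+-monoʳ-≤ s (dim-mono {T} {H}
        (λ y∈T x x∈S → resp S-sub (*-comm _ _) (ST⊆S x∈S y∈T)) dim-T (proj₂ dim-H))
    }
    where
    S-sub = dim-subspace dim-S
    H : Subset
    H y = ∀ x → x ∈ S → y * x ∈ S
    -- xS ⊆ S forces xS = S by dimension, so H is closed under inverses.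
    H-inverse : ∀ {y} → ¬ (y ≈ 0#) → y ∈ H → y ⁻¹ ∈ H
    H-inverse {y} y≉0 y∈H x x∈S =
      let v , v∈S , x≈yv = S⊆y·S x∈S in resp S-sub
        (sym (trans (*-congˡ x≈yv) (⁻¹-cancelˡ y≉0 v))) v∈S
      where
      S⊆y·S : S ⊆ y · S
      S⊆y·S = dim-≤⇒⊇ (λ (v , v∈S , z≈yv) → resp S-sub (sym z≈yv) (y∈H v v∈S)) ℕ.≤-refl
        (dim-· y≉0 dim-S) dim-S
    H-subfield : IsSubfield H
    H-subfield = record
      { resp       = λ y≈z y∈H x x∈S → resp S-sub (*-congʳ y≈z) (y∈H x x∈S)
      ; 0-closed   = λ x x∈S → resp S-sub (sym (zeroˡ _)) (0-closed S-sub)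
      ; 1-closed   = λ x x∈S → resp S-sub (sym (*-identityˡ _)) x∈S
      ; +-closed   = λ y∈H z∈H x x∈S → resp S-sub (sym (distribʳ _ _ _))
          (+-closed S-sub (y∈H x x∈S) (z∈H x x∈S))
      ; neg-closed = λ {y} y∈H x x∈S → resp S-sub
          (solve 2 (λ y x → :- (y :* x) := (:- y) :* x) refl y x) (neg∈ S-sub (y∈H x x∈S))
      ; *-closed   = λ y∈H z∈H x x∈S → resp S-sub (sym (*-assoc _ _ _)) (y∈H _ (z∈H x x∈S))
      ; ⁻¹-closed  = H-inverse
      }
    K⊆H : K ⊆ H
    K⊆H k∈K x x∈S = ·-closed S-sub k∈K x∈S
    dim-H : ∃ (Dim H)
    dim-H =
      let H-sub = subfield-subspace H-subfield K⊆H
          n , _ , dim-x₀H = subspace-dim {S} {x₀ · H} (·-subspace H-sub)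
            (λ (y , y∈H , z≈x₀y) → resp S-sub (trans (*-comm y x₀) (sym z≈x₀y)) (y∈H x₀ x₀∈S)) dim-S
      in n , dim-·⁻ x₀≉0 H-sub dim-x₀H

  -- The e-transform replaces (S , T) by (S + eT , T ∩ e⁻¹S), which keeps dim S + dim T and
  -- ST ⊆ A.  When no e shrinks T, ST ⊆ S and T lies in the stabilizer of S.
  dyson : ∀ fuel {A S T s t x₀} → t ≤ fuel → IsSubspace K A → Dim S s → Dim T t →
    x₀ ∈ S → ¬ (x₀ ≈ 0#) → 1# ∈ T → (∀ {x y} → x ∈ S → y ∈ T → x * y ∈ A) →
    StableSubspace A (s ℕ.+ t)
  dyson zero t≤0 A-sub dim-S dim-T x₀∈S x₀≉0 1∈T ST⊆A =
    contradiction (dim-positive 1∈T (0≉1 ∘ sym) dim-T) (ℕ.≤⇒≯ t≤0)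
  dyson (ℕ.suc fuel) {A} {S} {T} {s} {t} {x₀} t≤ A-sub dim-S dim-T x₀∈S x₀≉0 1∈T ST⊆A =
    cases (decide (∃[ e ] ∃[ y ] e ∈ S × y ∈ T × e * y ∉ S))
    where
    S-sub = dim-subspace dim-S
    T-sub = dim-subspace dim-T
    S⊆A : S ⊆ A
    S⊆A x∈S = resp A-sub (*-identityʳ _) (ST⊆A x∈S 1∈T)
    module Transform {e y} (e∈S : e ∈ S) (y∈T : y ∈ T) (ey∉S : e * y ∉ S) where
      e≉0 : ¬ (e ≈ 0#)
      e≉0 e≈0 = ey∉S (Zero-⊆ S-sub (lift (trans (*-congʳ e≈0) (zeroˡ y))))
      S′ T′ : Subset
      S′ = S ⊕ (e · T)
      T′ x = x ∈ T × e * x ∈ S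
      T′-sub : IsSubspace K T′
      T′-sub = record
        { resp     = λ x≈y (x∈T , ex∈S) → resp T-sub x≈y x∈T , resp S-sub (*-congˡ x≈y) ex∈S
        ; 0-closed = 0-closed T-sub , Zero-⊆ S-sub (lift (zeroʳ e))
        ; +-closed = λ (x∈T , ex∈S) (y∈T , ey∈S) → +-closed T-sub x∈T y∈T ,
            resp S-sub (sym (distribˡ e _ _)) (+-closed S-sub ex∈S ey∈S)
        ; ·-closed = λ {k} k∈K (x∈T , ex∈S) → ·-closed T-sub k∈K x∈T , resp S-sub
            (solve 3 (λ k e x → k :* (e :* x) := e :* (k :* x)) refl k e _)
            (·-closed S-sub k∈K ex∈S)
        }
      S∩eT≐eT′ : (e · T′) ≐ (S ∩ (e · T))
      S∩eT≐eT′ =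
        (λ (x , (x∈T , ex∈S) , z≈ex) → resp S-sub (sym z≈ex) ex∈S , x , x∈T , z≈ex) ,
        λ (z∈S , x , x∈T , z≈ex) → x , (x∈T , resp S-sub z≈ex z∈S) , z≈ex
      -- Write x = (x - w) + e v. The second part times z equals (e z) v, and e z lies in `S` by the
      -- choice of `T′`.
      products : ∀ {x z} → x ∈ S′ → z ∈ T′ → x * z ∈ A
      products {x} {z} (w , (v , v∈T , w≈ev) , d∈S) (z∈T , ez∈S) = resp A-sub
        (trans (+-congˡ (trans (solve 3 (λ e v z → (e :* z) :* v := (e :* v) :* z) refl e v z)
                 (*-congʳ (sym w≈ev))))
          (solve 3 (λ x w z → (x :- w) :* z :+ w :* z := x :* z) refl x w z))
        (+-closed A-sub (ST⊆A d∈S z∈T) (ST⊆A ez∈S v∈T))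
      result : StableSubspace A (s ℕ.+ t)
      result =
        let p , q , dim-S∩eT , dim-S′ , p+q≡s+t = inclusion-exclusion t dim-S (dim-· e≉0 dim-T)
            dim-T′ = dim-·⁻ e≉0 T′-sub (dim-resp S∩eT≐eT′ dim-S∩eT)
            p<t = dim-strict-mono {T′} {T} proj₁ y∈T (ey∉S ∘ proj₂) dim-T′ dim-T
        in ≡.subst (StableSubspace A) (≡.trans (ℕ.+-comm q p) p+q≡s+t)
             (dyson fuel (ℕ.s≤s⁻¹ (ℕ.≤-trans p<t t≤)) A-sub dim-S′ dim-T′
               (⊕-left S-sub (·-subspace T-sub) x₀∈S) x₀≉0
               -- The element 1 survives in `T′` because `e` was taken from `S`.
               (1∈T , resp S-sub (sym (*-identityʳ e)) e∈S) products)
    cases : Dec (∃[ e ] ∃[ y ] e ∈ S × y ∈ T × e * y ∉ S) → StableSubspace A (s ℕ.+ t)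
    cases (yes (e , y , e∈S , y∈T , ey∉S)) = Transform.result e∈S y∈T ey∉S
    cases (no none) = stabilizer-bound dim-S dim-T x₀∈S x₀≉0 S⊆A closed
      where
      closed : ∀ {x y} → x ∈ S → y ∈ T → x * y ∈ S
      closed {x} {y} x∈S y∈T with decide (x * y ∈ S)
      ... | yes xy∈S = xy∈S
      ... | no  xy∉S = contradiction (x , y , x∈S , y∈T , xy∉S) none

  -- Rado's theorem for subspaces

  Common : ∀ {k} → Subset → (Fin k → Subset) → FinSubset.Subset k → Subset
  Common B V J x = x ∈ B × (∀ i → i FinSubset.∈ J → x ∈ V i)

  Common-subspace : ∀ {k B} {V : Fin k → Subset} J → IsSubspace K B →
    (∀ i → IsSubspace K (V i)) → IsSubspace K (Common B V J)
  Common-subspace J B-sub V-sub = record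
    { resp     = λ x≈y (x∈B , x∈V) → resp B-sub x≈y x∈B , λ i i∈J → resp (V-sub i) x≈y (x∈V i i∈J)
    ; 0-closed = 0-closed B-sub , λ i _ → 0-closed (V-sub i)
    ; +-closed = λ (x∈B , x∈V) (y∈B , y∈V) → +-closed B-sub x∈B y∈B ,
        λ i i∈J → +-closed (V-sub i) (x∈V i i∈J) (y∈V i i∈J)
    ; ·-closed = λ k∈K (x∈B , x∈V) → ·-closed B-sub k∈K x∈B ,
        λ i i∈J → ·-closed (V-sub i) k∈K (x∈V i i∈J)
    }

  Common-outside : ∀ {k B} (V : Fin (ℕ.suc k) → Subset) J →
    Common B V (outside ∷ J) ≐ Common B (V ∘ Fin.suc) J
  Common-outside V J =
    (λ (x∈B , x∈V) → x∈B , λ i i∈J → x∈V (Fin.suc i) (there i∈J)) ,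
    λ (x∈B , x∈V) → x∈B , λ { (Fin.suc i) (there i∈J) → x∈V i i∈J }

  Common-inside : ∀ {k B} (V : Fin (ℕ.suc k) → Subset) J →
    Common B (V ∘ Fin.suc) J ⊆ V zero →
    Common B V (inside ∷ J) ≐ Common B (V ∘ Fin.suc) J
  Common-inside V J ⊆V₀ =
    (λ (x∈B , x∈V) → x∈B , λ i i∈J → x∈V (Fin.suc i) (there i∈J)) ,
    λ (x∈B , x∈V) → x∈B ,
      λ { zero _ → ⊆V₀ (x∈B , x∈V) ; (Fin.suc i) (there i∈J) → x∈V i i∈J }

  Common-⊥ : ∀ {k B} (V : Fin k → Subset) → Common B V FinSubset.⊥ ≐ B
  Common-⊥ V = proj₁ , λ x∈B → x∈B , λ i i∈⊥ → ⊥-elim (FinSubset.∉⊥ i∈⊥)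

  -- With k = dim B and M = k + d this is Rado's condition with defect d, in dual form: the
  -- annihilators indexed by `J` span dimension k - u, which has to be at least ∣J∣ - d.
  Bounded : ∀ {k} → Subset → (Fin k → Subset) → ℕ → Set (suc (c ⊔ r))
  Bounded B V M = ∀ J u → Dim (Common B V J) u → u ℕ.+ ∣ J ∣ ≤ M

  -- Sets attaining the bound are closed under union, so the one with the smallest
  -- intersection lies below all of them.
  tight-least : ∀ {k B m M} {V : Fin k → Subset} → Dim B m → (∀ i → IsSubspace K (V i)) →
    Bounded B V M → ∀ J T {j t} → Dim (Common B V J) j → j ℕ.+ ∣ J ∣ ≡ M →
    Dim (Common B V T) t → t ℕ.+ ∣ T ∣ ≡ M →
    (∀ J u → Dim (Common B V J) u → u ℕ.+ ∣ J ∣ ≡ M → t ≤ u) →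
    Common B V T ⊆ Common B V J
  tight-least {B = B} {M = M} {V = V} dim-B V-sub bounded J T {j} {t} dim-J j+J≡M dim-T t+T≡M t-least =
    λ x∈T → proj₁ (T⊆ x∈T)
    where
    B-sub = dim-subspace dim-B
    ∪≐ : Common B V (J FinSubset.∪ T) ≐ (Common B V J ∩ Common B V T)
    ∪≐ =
      (λ (x∈B , x∈V) →
        (x∈B , λ i i∈J → x∈V i (FinSubset.p⊆p∪q T i∈J)) ,
        (x∈B , λ i i∈T → x∈V i (FinSubset.q⊆p∪q J T i∈T))) ,
      λ ((x∈B , x∈VJ) , (_ , x∈VT)) → x∈B , λ i i∈J∪T →
        [ x∈VJ i , x∈VT i ]′ (FinSubset.x∈p∪q⁻ J T i∈J∪T)
    ⊕⊆ : Common B V J ⊕ Common B V T ⊆ Common B V (J FinSubset.∩ T)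
    ⊕⊆ = ⊕-least (Common-subspace _ B-sub V-sub)
      (λ (x∈B , x∈V) → x∈B , λ i i∈J∩T → x∈V i (proj₁ (FinSubset.x∈p∩q⁻ J T i∈J∩T)))
      (λ (x∈B , x∈V) → x∈B , λ i i∈J∩T → x∈V i (proj₂ (FinSubset.x∈p∩q⁻ J T i∈J∩T)))
    -- Supermodularity: the values of dim + size at the union and the intersection add up to at
    -- least 2M, and neither exceeds M, so the union attains the bound.
    union-tight : ∀ {p q} → p ℕ.+ q ≡ j ℕ.+ t → p ℕ.+ ∣ J FinSubset.∪ T ∣ ≤ M →
      q ℕ.+ ∣ J FinSubset.∩ T ∣ ≤ M → p ℕ.+ ∣ J FinSubset.∪ T ∣ ≡ M
    union-tight {p} {q} p+q≡j+t p+∪≤M q+∩≤M = ℕ.≤-antisym p+∪≤M (ℕ.+-cancelʳ-≤ M M _ (begin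
      M ℕ.+ M                             ≡⟨ ≡.cong₂ ℕ._+_ (≡.sym j+J≡M) (≡.sym t+T≡M) ⟩
      (j ℕ.+ ∣ J ∣) ℕ.+ (t ℕ.+ ∣ T ∣)     ≡⟨ interchange j _ t _ ⟩
      (j ℕ.+ t) ℕ.+ (∣ J ∣ ℕ.+ ∣ T ∣)     ≡⟨ ≡.cong₂ ℕ._+_ (≡.sym p+q≡j+t) (≡.sym (∣p∪q∣+∣p∩q∣ J T)) ⟩
      (p ℕ.+ q) ℕ.+ (∪ ℕ.+ ∩′)            ≡⟨ interchange p q _ _ ⟩
      (p ℕ.+ ∪) ℕ.+ (q ℕ.+ ∩′)            ≤⟨ ℕ.+-monoʳ-≤ (p ℕ.+ ∪) q+∩≤M ⟩
      (p ℕ.+ ∪) ℕ.+ M                     ∎))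
      where
      open ℕ.≤-Reasoning
      ∪ = ∣ J FinSubset.∪ T ∣
      ∩′ = ∣ J FinSubset.∩ T ∣
      interchange : ∀ w x y z → (w ℕ.+ x) ℕ.+ (y ℕ.+ z) ≡ (w ℕ.+ y) ℕ.+ (x ℕ.+ z)
      interchange = CommutativeSemigroup.interchange ℕ.+-commutativeSemigroup
    T⊆ : Common B V T ⊆ (Common B V J ∩ Common B V T)
    T⊆ =
      let p , q , dim-∩ , dim-⊕ , p+q≡j+t = inclusion-exclusion t dim-J dim-T
          q′ , _ , dim-J∩T = subspace-dim (Common-subspace (J FinSubset.∩ T) B-sub V-sub) proj₁ dim-B
          dim-J∪T = dim-resp ∪≐ dim-∩
          p+∪≡M = union-tight p+q≡j+t (bounded _ _ dim-J∪T)
            (ℕ.≤-trans (ℕ.+-monoˡ-≤ _ (dim-mono ⊕⊆ dim-⊕ dim-J∩T)) (bounded _ _ dim-J∩T))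
      -- The intersection is the common space of the tight set `J ∪ T`, so its dimension is at least
      -- `t` by minimality.
      in dim-≤⇒⊇ proj₂ (t-least _ _ dim-J∪T p+∪≡M) dim-∩ dim-T

  -- A vector of the smallest tight space lies in all tight spaces, so it suffices to leave `W`
  -- inside that one. If no set is tight, any vector of `B` outside `W` serves.
  tight-witness : ∀ {k B m M} {W : Subset} {V : Fin k → Subset} → Dim B m → (∀ i → IsSubspace K (V i)) →
    Bounded B V M → ∃[ x ] x ∈ B × x ∉ W →
    (∀ J u → Dim (Common B V J) u → u ℕ.+ ∣ J ∣ ≡ M → ∃[ x ] x ∈ Common B V J × x ∉ W) →
    ∃[ x ] x ∈ B × x ∉ W ×
      (∀ J u → Dim (Common B V J) u → u ℕ.+ ∣ J ∣ ≡ M → x ∈ Common B V J)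
  tight-witness {k} {B} {m} {M} {W} {V} dim-B V-sub bounded (x , x∈B , x∉W) tight⊈W =
    cases lem
    where
    Tight : Pred ℕ (suc (c ⊔ r))
    Tight u = Σ[ J ∈ FinSubset.Subset k ] Dim (Common B V J) u × u ℕ.+ ∣ J ∣ ≡ M
    cases : Dec (∃ Tight) → ∃[ x ] x ∈ B × x ∉ W ×
      (∀ J u → Dim (Common B V J) u → u ℕ.+ ∣ J ∣ ≡ M → x ∈ Common B V J)
    cases (no none) = x , x∈B , x∉W ,
      λ J u dim-J u+J≡M → ⊥-elim (none (u , J , dim-J , u+J≡M))
    cases (yes tight) =
      let t , (T , dim-T , t+T≡M) , t-least = least lem tight
          y , y∈T , y∉W = tight⊈W T t dim-T t+T≡M
      in y , proj₁ y∈T , y∉W , λ J u dim-J u+J≡M →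
           tight-least dim-B V-sub bounded J T dim-J u+J≡M dim-T t+T≡M
             (λ J′ u′ dim-J′ eq → t-least u′ (J′ , dim-J′ , eq)) y∈T

  record Section {k} (B : Subset) (V : Fin k → Subset) (W : Subset) (m D : ℕ) :
      Set (suc (c ⊔ r)) where
    field
      {H}     : Subset
      {y}     : Carrier
      W⊆H     : W ⊆ H
      H⊆B     : H ⊆ B
      y∈B     : y ∈ B
      y∉H     : y ∉ H
      dim-H   : Dim H m
      bounded : Bounded H V (m ℕ.+ D)

  -- The bound has to drop by one along with dim B. Sets that are not tight have a unit to spare.
  -- Tight ones have a common space containing `y ∉ H`, which therefore loses a dimension in `H`.
  section : ∀ {k B m D W} {V : Fin k → Subset} → Dim B (ℕ.suc m) → (∀ i → IsSubspace K (V i)) →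
    Bounded B V (ℕ.suc m ℕ.+ D) → IsSubspace K W → W ⊆ B → ∃[ x ] x ∈ B × x ∉ W →
    (∀ J u → Dim (Common B V J) u → u ℕ.+ ∣ J ∣ ≡ ℕ.suc m ℕ.+ D → ∃[ x ] x ∈ Common B V J × x ∉ W) →
    Section B V W m D
  section {k} {B} {m} {D} {W} {V} dim-B V-sub bounded W-sub W⊆B B⊈W tight⊈W =
    let y , y∈B , y∉W , y∈tight = tight-witness dim-B V-sub bounded B⊈W tight⊈W
        H , W⊆H , H⊆B , y∉H , dim-H = hyperplane-avoiding W-sub W⊆B y∈B y∉W dim-B
    in record
      { W⊆H     = W⊆H
      ; H⊆B     = H⊆B
      ; y∈B     = y∈B
      ; y∉H     = y∉H
      ; dim-H   = dim-H
      ; bounded = λ J u dim-u → bound H⊆B y∉H y∈tight J u dim-u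
      }
    where
    bound : ∀ {H y} → H ⊆ B → y ∉ H →
      (∀ J u → Dim (Common B V J) u → u ℕ.+ ∣ J ∣ ≡ ℕ.suc m ℕ.+ D → y ∈ Common B V J) →
      Bounded H V (m ℕ.+ D)
    bound {H} {y} H⊆B y∉H y∈tight J u dim-u
      with subspace-dim (Common-subspace {B = B} {V} J (dim-subspace dim-B) V-sub) proj₁ dim-B
    ... | u′ , _ , dim-u′ = cases (ℕ.m≤n⇒m<n∨m≡n (bounded J u′ dim-u′))
      where
      H∩⊆B∩ : Common H V J ⊆ Common B V J
      H∩⊆B∩ (x∈H , x∈V) = H⊆B x∈H , x∈V
      cases : u′ ℕ.+ ∣ J ∣ < ℕ.suc m ℕ.+ D ⊎ u′ ℕ.+ ∣ J ∣ ≡ ℕ.suc m ℕ.+ D → u ℕ.+ ∣ J ∣ ≤ m ℕ.+ D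
      cases (inj₁ <M) =
        ℕ.≤-trans (ℕ.+-monoˡ-≤ ∣ J ∣ (dim-mono H∩⊆B∩ dim-u dim-u′)) (ℕ.s≤s⁻¹ <M)
      cases (inj₂ ≡M) = ℕ.s≤s⁻¹ (ℕ.≤-trans
        (ℕ.+-monoˡ-≤ ∣ J ∣ (dim-strict-mono H∩⊆B∩ (y∈tight J u′ dim-u′ ≡M) (y∉H ∘ proj₁) dim-u dim-u′))
        (ℕ.≤-reflexive ≡M))

  -- Gᵢ is the hyperplane of B spanned by the bⱼ with j ≠ i; interpolate says that the
  -- functionals with kernels Gᵢ are independent.
  record Transversal {k} (B : Subset) (V : Fin k → Subset) (d : ℕ) : Set (suc (c ⊔ r)) where
    field
      {b}         : Vector Carrier k
      flag        : Flag b B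
      P           : FinSubset.Subset k
      size        : k ≤ ∣ P ∣ ℕ.+ d
      G           : Fin k → Subset
      G-subspace  : ∀ i → i FinSubset.∈ P → IsSubspace K (G i)
      G⊆B         : ∀ i → i FinSubset.∈ P → G i ⊆ B
      V∩B⊆G       : ∀ i → i FinSubset.∈ P → V i ∩ B ⊆ G i
      b∈G         : ∀ i → i FinSubset.∈ P → ∀ j → j ≢ i → b j ∈ G i
      b∉G         : ∀ i → i FinSubset.∈ P → b i ∉ G i
      interpolate : (h : Vector Carrier k) → (∀ i → h i ∈ B) →
        ∃[ w ] w ∈ B × (∀ i → i FinSubset.∈ P → h i - w ∈ G i)

  -- Passing from `H` to `B` enlarges each V i ∩ H by at most one vector, which may be taken to be y
  -- - hᵢ with hᵢ in `H`. The hyperplane `G i ⊞ b₀` with b₀ = y - w contains it as soon as hᵢ - w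
  -- lies in `G i`, and `interpolate` supplies a single `w` for all i. The argument `count` covers
  -- both uses: index zero is matched, or it costs one unit of defect.
  extend-transversal : ∀ {k B H y d d′} {V : Fin (ℕ.suc k) → Subset} side →
    (∀ {p} → k ≤ p ℕ.+ d → ℕ.suc k ≤ ∣ side ∷ [] ∣ ℕ.+ p ℕ.+ d′) →
    IsSubspace K B → (∀ i → IsSubspace K (V i)) → H ⊆ B → y ∈ B → y ∉ H → B ⊆ H ⊞ y →
    (side ≡ inside → V zero ∩ B ⊆ H) → Transversal H (V ∘ Fin.suc) d → Transversal B V d′
  extend-transversal {k} {B} {H} {y} {d} {d′} {V} side count B-sub V-sub H⊆B y∈B y∉H B⊆ V₀⊆H tr = result
    where
    open Transversal tr
    H-sub = flag-subspace flag

    target : ∀ i → ∃[ h ] h ∈ H × (∀ {x} → x ∈ V (Fin.suc i) → x ∈ B →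
      ∃[ k ] k ∈ K × x - k * (y - h) ∈ V (Fin.suc i) ∩ H)
    target i with ⊆-or-counterexample (V (Fin.suc i) ∩ B) H
    -- Nothing is gained in passing to `B`, so no condition on `w` arises and zero is a dummy
    -- target.
    ... | inj₁ V∩B⊆H = 0# , 0-closed H-sub , λ {x} x∈V x∈B → 0# , 0-closed K-subfield ,
      (let x≈ = solve 2 (λ x y → x := x :- con (+ 0) :* y) refl x (y - 0#)
       in resp (V-sub (Fin.suc i)) x≈ x∈V , resp H-sub x≈ (V∩B⊆H (x∈V , x∈B)))
    ... | inj₂ (v , (v∈V , v∈B) , v∉H) =
      let l , l∈K , h∈H = ⊞-hyperplane H-sub B⊆ v∈B v∉H y∈B
      -- With this choice y - h = l v is a multiple of `v`, hence lies in the required space.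
      in y - l * v , h∈H , λ {x} x∈V x∈B →
        let k , k∈K , d∈H = B⊆ x∈B in k , k∈K ,
        resp (V-sub (Fin.suc i))
          (solve 5 (λ x k y l v → x :- (k :* l) :* v := x :- k :* (y :- (y :- l :* v)))
            refl x k y l v)
          (-∈ (V-sub (Fin.suc i)) x∈V
            (·-closed (V-sub (Fin.suc i)) (*-closed K-subfield k∈K l∈K) v∈V)) ,
        resp H-sub
          (solve 4 (λ x k y h → (x :- k :* y) :+ k :* h := x :- k :* (y :- h)) refl x k y (y - l * v))
          (+-closed H-sub d∈H (·-closed H-sub k∈K h∈H))

    h : Vector Carrier k
    h i = proj₁ (target i)

    interpolated : ∃[ w ] w ∈ H × (∀ i → i FinSubset.∈ P → h i - w ∈ G i)
    interpolated = interpolate h (λ i → proj₁ (proj₂ (target i)))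
    w : Carrier
    w = proj₁ interpolated
    w∈H : w ∈ H
    w∈H = proj₁ (proj₂ interpolated)

    b₀ : Carrier
    b₀ = y - w
    b₀∈B : b₀ ∈ B
    b₀∈B = -∈ B-sub y∈B (H⊆B w∈H)
    b₀∉H : b₀ ∉ H
    b₀∉H b₀∈H = y∉H (resp H-sub (solve 2 (λ y w → (y :- w) :+ w := y) refl y w)
      (+-closed H-sub b₀∈H w∈H))
    B⊆H⊞b₀ : B ⊆ H ⊞ b₀
    B⊆H⊞b₀ = ⊞-hyperplane H-sub B⊆ b₀∈B b₀∉H

    G′ : Fin (ℕ.suc k) → Subset
    G′ zero        = H
    G′ (Fin.suc i) = G i ⊞ b₀

    member : ∀ {i} → Fin.suc i FinSubset.∈ (side ∷ P) → i FinSubset.∈ P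
    member = FinSubset.drop-there

    G′-subspace : ∀ i → i FinSubset.∈ (side ∷ P) → IsSubspace K (G′ i)
    G′-subspace zero        _   = H-sub
    G′-subspace (Fin.suc i) i∈P = ⊞-subspace (G-subspace i (member i∈P))

    G′⊆B : ∀ i → i FinSubset.∈ (side ∷ P) → G′ i ⊆ B
    G′⊆B zero        _   = H⊆B
    G′⊆B (Fin.suc i) i∈P = ⊞-least B-sub (λ x∈G → H⊆B (G⊆B i (member i∈P) x∈G)) b₀∈B

    V∩B⊆G′ : ∀ i → i FinSubset.∈ (side ∷ P) → V i ∩ B ⊆ G′ i
    V∩B⊆G′ zero        0∈P = V₀⊆H (0∈p⇒inside 0∈P)
    V∩B⊆G′ (Fin.suc i) i∈P {x} (x∈V , x∈B) =
      let k , k∈K , z∈V∩H = proj₂ (proj₂ (target i)) x∈V x∈B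
          Gᵢ-sub = G-subspace i (member i∈P)
      in k , k∈K , resp Gᵢ-sub
        (solve 5 (λ x k y h w → (x :- k :* (y :- h)) :- k :* (h :- w) := x :- k :* (y :- w))
          refl x k y (h i) w)
        (-∈ Gᵢ-sub (V∩B⊆G i (member i∈P) z∈V∩H)
          (·-closed Gᵢ-sub k∈K (proj₂ (proj₂ interpolated) i (member i∈P))))

    b∈G′ : ∀ i → i FinSubset.∈ (side ∷ P) → ∀ j → j ≢ i → (b₀ Vector.∷ b) j ∈ G′ i
    b∈G′ zero        _   zero        j≢i = contradiction ≡.refl j≢i
    b∈G′ zero        _   (Fin.suc j) j≢i = flag-∈ flag j
    b∈G′ (Fin.suc i) i∈P zero        j≢i = ⊞-contains (G-subspace i (member i∈P))
    b∈G′ (Fin.suc i) i∈P (Fin.suc j) j≢i =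
      ⊞-extends (G-subspace i (member i∈P)) (b∈G i (member i∈P) j (j≢i ∘ ≡.cong Fin.suc))

    b∉G′ : ∀ i → i FinSubset.∈ (side ∷ P) → (b₀ Vector.∷ b) i ∉ G′ i
    b∉G′ zero        _   = b₀∉H
    b∉G′ (Fin.suc i) i∈P bᵢ∈ = b∉G i (member i∈P)
      (⊞-retract (G-subspace i (member i∈P)) H-sub (G⊆B i (member i∈P)) b₀∉H (flag-∈ flag i) bᵢ∈)

    interpolate′ : (h : Vector Carrier (ℕ.suc k)) → (∀ i → h i ∈ B) →
      ∃[ w ] w ∈ B × (∀ i → i FinSubset.∈ (side ∷ P) → h i - w ∈ G′ i)
    -- The condition at index zero is taken modulo `H` and prescribes the coefficient of `b₀`. All
    -- other hyperplanes contain `b₀`, so only the components in `H` have to be interpolated there.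
    interpolate′ h h∈B = w′ + ν zero * b₀ ,
      +-closed B-sub (H⊆B w′∈H) (·-closed B-sub (ν∈K zero) b₀∈B) , λ where
        zero _ → resp H-sub
          (solve 3 (λ h w y → (h :- y) :- w := h :- (w :+ y)) refl (h zero) w′ (ν zero * b₀))
          (-∈ H-sub (η∈H zero) w′∈H)
        (Fin.suc i) i∈P → ν (Fin.suc i) - ν zero ,
          +-closed K-subfield (ν∈K (Fin.suc i)) (neg-closed K-subfield (ν∈K zero)) ,
          resp (G-subspace i (member i∈P))
            (solve 5 (λ h w m n y → (h :- m :* y) :- w := (h :- (w :+ n :* y)) :- (m :- n) :* y)
              refl (h (Fin.suc i)) w′ (ν (Fin.suc i)) (ν zero) b₀)
            (η-w′∈G i (member i∈P))
      where
      ν : Vector Carrier (ℕ.suc k)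
      ν i = _⊞_.coefficient (B⊆H⊞b₀ (h∈B i))
      ν∈K : ∀ i → ν i ∈ K
      ν∈K i = proj₁ (_⊞_.difference (B⊆H⊞b₀ (h∈B i)))
      η∈H : ∀ i → h i - ν i * b₀ ∈ H
      η∈H i = proj₂ (_⊞_.difference (B⊆H⊞b₀ (h∈B i)))
      solution : ∃[ w ] w ∈ H ×
        (∀ i → i FinSubset.∈ P → (h (Fin.suc i) - ν (Fin.suc i) * b₀) - w ∈ G i)
      solution = interpolate (λ i → h (Fin.suc i) - ν (Fin.suc i) * b₀) (η∈H ∘ Fin.suc)
      w′ : Carrier
      w′ = proj₁ solution
      w′∈H : w′ ∈ H
      w′∈H = proj₁ (proj₂ solution)
      η-w′∈G : ∀ i → i FinSubset.∈ P → (h (Fin.suc i) - ν (Fin.suc i) * b₀) - w′ ∈ G i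
      η-w′∈G = proj₂ (proj₂ solution)

    -- Splitting on `side` lets the size of `side ∷ P` compute.
    size′ : ∀ side → (∀ {p} → k ≤ p ℕ.+ d → ℕ.suc k ≤ ∣ side ∷ [] ∣ ℕ.+ p ℕ.+ d′) →
      ℕ.suc k ≤ ∣ side ∷ P ∣ ℕ.+ d′
    size′ true  count = count size
    size′ false count = count size

    result : Transversal B V d′
    result = record
      { b           = b₀ Vector.∷ b
      ; flag        = step b₀∉H flag (B⊆H⊞b₀ , ⊞-least B-sub H⊆B b₀∈B)
      ; P           = side ∷ P
      ; size        = size′ side count
      ; G           = G′
      ; G-subspace  = G′-subspace
      ; G⊆B         = G′⊆B
      ; V∩B⊆G       = V∩B⊆G′
      ; b∈G         = b∈G′
      ; b∉G         = b∉G′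
      ; interpolate = interpolate′
      }

  nonzero-element : ∀ {V n} → Dim V (ℕ.suc n) → ∃[ x ] x ∈ V × x ∉ Zero
  nonzero-element (b , step y∉W flag V≐) =
    head b , proj₂ V≐ (⊞-contains (flag-subspace flag)) , y∉W ∘ Zero-⊆ (flag-subspace flag)

  hyperplane-generates : ∀ {B H y m} → H ⊆ B → y ∈ B → y ∉ H → Dim H m → Dim B (ℕ.suc m) →
    B ⊆ H ⊞ y
  hyperplane-generates H⊆B y∈B y∉H dim-H dim-B =
    dim-≤⇒⊇ (⊞-least (dim-subspace dim-B) H⊆B y∈B) ℕ.≤-refl (dim-⊞ y∉H dim-H) dim-B

  -- Induction on dim B. If `V zero` does not contain `B`, index zero is matched by a hyperplane
  -- through V zero ∩ B. If it does, index zero has to be given up at the cost of one unit of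
  -- defect; for d = 0 the bound at J = {0} excludes this case.
  rado : ∀ k d {B} {V : Fin k → Subset} → Dim B k → (∀ i → IsSubspace K (V i)) →
    Bounded B V (k ℕ.+ d) → Transversal B V d
  rado zero d (b , flag) V-sub bounded = record
    { flag        = flag
    ; P           = []
    ; size        = z≤n
    ; G           = λ ()
    ; G-subspace  = λ ()
    ; G⊆B         = λ ()
    ; V∩B⊆G       = λ ()
    ; b∈G         = λ ()
    ; b∉G         = λ ()
    ; interpolate = λ _ _ → 0# , 0-closed (flag-subspace flag) , λ ()
    }
  rado (ℕ.suc k) d {B} {V} dim-B V-sub bounded = cases (⊆-or-counterexample B (V zero)) d bounded
    where
    B-sub = dim-subspace dim-B
    V₊-sub : ∀ i → IsSubspace K (V (Fin.suc i))
    V₊-sub = V-sub ∘ Fin.suc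

    extend : ∀ {W d d′} side →
      (∀ {p} → k ≤ p ℕ.+ d → ℕ.suc k ≤ ∣ side ∷ [] ∣ ℕ.+ p ℕ.+ d′) →
      (side ≡ inside → V zero ∩ B ⊆ W) → Section B (V ∘ Fin.suc) W k d → Transversal B V d′
    extend {d = d} side count V₀⊆W sec =
      extend-transversal side count B-sub V-sub H⊆B y∈B y∉H
        (hyperplane-generates H⊆B y∈B y∉H dim-H dim-B)
        (λ eq x∈ → W⊆H (V₀⊆W eq x∈)) (rado k d dim-H V₊-sub bounded′)
      where open Section sec renaming (bounded to bounded′)

    cases : B ⊆ V zero ⊎ ∃[ x ] x ∈ B × x ∉ V zero → ∀ d → Bounded B V (ℕ.suc k ℕ.+ d) →
      Transversal B V d
    cases (inj₁ B⊆V₀) zero bounded = contradiction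
      (bounded (inside ∷ FinSubset.⊥) (ℕ.suc k)
        (dim-resp (≐-trans (Common-inside V FinSubset.⊥ (B⊆V₀ ∘ proj₁)) (Common-⊥ (V ∘ Fin.suc))) dim-B))
      (ℕ.<⇒≱ (s≤s (ℕ.+-monoʳ-< k (s≤s z≤n))))
    cases (inj₁ B⊆V₀) (ℕ.suc d) bounded =
      extend outside (λ {p} k≤ → ≡.subst (ℕ.suc k ≤_) (≡.sym (ℕ.+-suc p d)) (s≤s k≤)) (λ ())
        (section dim-B V₊-sub bounded₊ Zero-subspace (Zero-⊆ B-sub) (nonzero-element dim-B) nonzero)
      where
      bounded₊ : Bounded B (V ∘ Fin.suc) (ℕ.suc k ℕ.+ d)
      bounded₊ J u dim-J = ℕ.s≤s⁻¹ (≡.subst₂ _≤_ (ℕ.+-suc u ∣ J ∣) (ℕ.+-suc (ℕ.suc k) d)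
        (bounded (inside ∷ J) u (dim-resp (Common-inside V J (B⊆V₀ ∘ proj₁)) dim-J)))
      -- At most k indices are available, fewer than the bound, so a tight set cannot have a zero
      -- common space.
      nonzero : ∀ J u → Dim (Common B (V ∘ Fin.suc) J) u → u ℕ.+ ∣ J ∣ ≡ ℕ.suc k ℕ.+ d →
        ∃[ x ] x ∈ Common B (V ∘ Fin.suc) J × x ∉ Zero
      nonzero J zero dim-J ∣J∣≡ = contradiction (FinSubset.∣p∣≤n J)
        (ℕ.<⇒≱ (≡.subst (k <_) (≡.sym ∣J∣≡) (s≤s (ℕ.m≤m+n k d))))
      nonzero J (ℕ.suc u) dim-J _ = nonzero-element dim-J
    cases (inj₂ (x , x∈B , x∉V₀)) d bounded =
      extend inside s≤s (λ _ x∈ → x∈)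
        (section dim-B V₊-sub bounded₊ (∩-subspace (V-sub zero) B-sub) proj₂
          (x , x∈B , x∉V₀ ∘ proj₁) outside-V₀)
      where
      bounded₊ : Bounded B (V ∘ Fin.suc) (ℕ.suc k ℕ.+ d)
      bounded₊ J u dim-J = bounded (outside ∷ J) u (dim-resp (Common-outside V J) dim-J)
      outside-V₀ : ∀ J u → Dim (Common B (V ∘ Fin.suc) J) u → u ℕ.+ ∣ J ∣ ≡ ℕ.suc k ℕ.+ d →
        ∃[ x ] x ∈ Common B (V ∘ Fin.suc) J × x ∉ V zero ∩ B
      outside-V₀ J u dim-J u+J≡ with ⊆-or-counterexample (Common B (V ∘ Fin.suc) J) (V zero ∩ B)
      ... | inj₂ witness = witness
      -- Adding index zero would keep the common space and raise the size of `J` past the bound.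
      ... | inj₁ J⊆V₀ = contradiction
        (bounded (inside ∷ J) u (dim-resp (Common-inside V J (λ x∈ → proj₁ (J⊆V₀ x∈))) dim-J))
        (ℕ.<⇒≱ (≡.subst₂ _<_ u+J≡ (≡.sym (ℕ.+-suc u ∣ J ∣)) ℕ.≤-refl))

  -- Spans of bases with one vector omitted

  Combination-subspace : ∀ {n} (b : Vector Carrier n) → IsSubspace K (Combination b)
  Combination-subspace {zero} b = ≐-subspace
    ((λ (_ , _ , x≈0) → lift x≈0) , λ { (lift x≈0) → Vector.[] , (λ ()) , x≈0 }) Zero-subspace
  Combination-subspace {ℕ.suc n} b =
    ≐-subspace (combination-⊞ b) (⊞-subspace (Combination-subspace (tail b)))

  Combination-∈ : ∀ {n} (b : Vector Carrier n) i → b i ∈ Combination b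
  Combination-∈ b zero = proj₂ (combination-⊞ b) (⊞-contains (Combination-subspace (tail b)))
  Combination-∈ b (Fin.suc i) = proj₂ (combination-⊞ b)
    (⊞-extends (Combination-subspace (tail b)) (Combination-∈ (tail b) i))

  Omit : ∀ {n} → Vector Carrier (ℕ.suc n) → Fin (ℕ.suc n) → Subset
  Omit b i = Combination (Vector.removeAt b i)

  Omit⊆Span : ∀ {n} (b : Vector Carrier (ℕ.suc n)) i → Omit b i ⊆ Span K (RangeOmitting b i)
  Omit⊆Span {n} b i (k , k∈K , x≈sum) =
    n , k , Vector.removeAt b i , k∈K , (λ j → punchIn i j , punchInᵢ≢i i j , refl) , x≈sum

  Omit-∈ : ∀ {n} (b : Vector Carrier (ℕ.suc n)) i j → j ≢ i → b j ∈ Omit b i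
  Omit-∈ b i j j≢i = ≡.subst (λ j → b j ∈ Omit b i) (punchIn-punchOut (j≢i ∘ ≡.sym))
    (Combination-∈ (Vector.removeAt b i) (punchOut (j≢i ∘ ≡.sym)))

  hyperplane⊆Span : ∀ {n} {b : Vector Carrier (ℕ.suc n)} {B G} i → Flag b B → IsSubspace K G →
    (∀ j → j ≢ i → b j ∈ G) → b i ∉ G → G ∩ B ⊆ Span K (RangeOmitting b i)
  hyperplane⊆Span {n} {b} {B} {G} i flag G-sub b∈G b∉G (x∈G , x∈B) =
    Omit⊆Span b i (⊞-retract R-sub G-sub R⊆G b∉G x∈G (B⊆ x∈B))
    where
    R-sub = Combination-subspace (Vector.removeAt b i)
    R⊆G : Omit b i ⊆ G
    R⊆G (k , k∈K , x≈sum) = resp G-sub (sym x≈sum)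
      (sum-closed G-sub k (Vector.removeAt b i) k∈K λ j → b∈G (punchIn i j) (punchInᵢ≢i i j))
    all∈ : ∀ j → b j ∈ Omit b i ⊞ b i
    all∈ j with j ≟ i
    ... | yes ≡.refl = ⊞-contains R-sub
    ... | no  j≢i    = ⊞-extends R-sub (Omit-∈ b i j j≢i)
    B⊆ : B ⊆ Omit b i ⊞ b i
    B⊆ = flag-least (⊞-subspace R-sub) flag all∈

  Span-tail : ∀ {n} {b : Vector Carrier (ℕ.suc n)} {W} → IsSubspace K W →
    (∀ j → tail b j ∈ W) → head b ∉ W → ∀ i →
    Span K (RangeOmitting b (Fin.suc i)) ∩ W ⊆ Span K (RangeOmitting (tail b) i)
  Span-tail {ℕ.suc n} {b} {W} W-sub b∈W b₀∉W i (x∈Span , x∈W) =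
    Omit⊆Span (tail b) i (⊞-retract R-sub W-sub R⊆W b₀∉W x∈W (Span⊆ x∈Span))
    where
    R = Omit (tail b) i
    R-sub = Combination-subspace (Vector.removeAt (tail b) i)
    R⊆W : R ⊆ W
    R⊆W (k , k∈K , x≈sum) = resp W-sub (sym x≈sum)
      (sum-closed W-sub k (Vector.removeAt (tail b) i) k∈K λ j → b∈W (punchIn i j))
    generators : RangeOmitting b (Fin.suc i) ⊆ R ⊞ head b
    generators (zero , _ , x≈b₀) =
      resp (⊞-subspace R-sub) (sym x≈b₀) (⊞-contains R-sub)
    generators (Fin.suc j , j≢i , x≈bⱼ) =
      resp (⊞-subspace R-sub) (sym x≈bⱼ)
        (⊞-extends R-sub (Omit-∈ (tail b) i j (j≢i ∘ ≡.cong Fin.suc)))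
    Span⊆ : Span K (RangeOmitting b (Fin.suc i)) ⊆ R ⊞ head b
    Span⊆ = Span-least {X = RangeOmitting b (Fin.suc i)} (⊞-subspace R-sub) generators

  -- `X` lies in the intersection of ∣Q∣ coordinate hyperplanes, which is spanned by the remaining n
  -- - ∣Q∣ basis vectors. Along the flag, omitting the head puts `X` into `W`; otherwise passing to
  -- `X ∩ W` costs at most one dimension.
  omitted-bound : ∀ {n} {b : Vector Carrier n} {B X x} → Flag b B → (Q : FinSubset.Subset n) →
    Dim X x → X ⊆ B → (∀ i → i FinSubset.∈ Q → X ⊆ Span K (RangeOmitting b i)) →
    x ℕ.+ ∣ Q ∣ ≤ n
  omitted-bound {x = x} flag@([] _) [] dim-X X⊆B _ =
    ≡.subst (_≤ 0) (≡.sym (ℕ.+-identityʳ x)) (dim-mono X⊆B dim-X (_ , flag))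
  omitted-bound {ℕ.suc n} {b} {B} {X} {x} (step {W = W} b₀∉W flag B≐) (inside ∷ Q) dim-X X⊆B X⊆Span =
    ≡.subst (_≤ ℕ.suc n) (≡.sym (ℕ.+-suc x ∣ Q ∣))
      (s≤s (omitted-bound flag Q dim-X X⊆W λ i i∈Q x∈X →
        Span-tail W-sub (flag-∈ flag) b₀∉W i (X⊆Span (Fin.suc i) (there i∈Q) x∈X , X⊆W x∈X)))
    where
    W-sub = flag-subspace flag
    generators : RangeOmitting b zero ⊆ W
    generators (zero , j≢0 , _) = contradiction ≡.refl j≢0
    generators (Fin.suc j , _ , x≈bⱼ) = resp W-sub (sym x≈bⱼ) (flag-∈ flag j)
    X⊆W : X ⊆ W
    X⊆W x∈X = Span-least {X = RangeOmitting b zero} W-sub generators (X⊆Span zero here x∈X)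
  omitted-bound {ℕ.suc n} {b} {B} {X} {x} (step {W = W} b₀∉W flag B≐) (outside ∷ Q) dim-X X⊆B X⊆Span =
    cases (⊆-or-counterexample X W)
    where
    W-sub = flag-subspace flag
    in-tail : ∀ i → i FinSubset.∈ Q → X ∩ W ⊆ Span K (RangeOmitting (tail b) i)
    in-tail i i∈Q (x∈X , x∈W) =
      Span-tail W-sub (flag-∈ flag) b₀∉W i (X⊆Span (Fin.suc i) (there i∈Q) x∈X , x∈W)
    cases : X ⊆ W ⊎ ∃[ y ] y ∈ X × y ∉ W → x ℕ.+ ∣ Q ∣ ≤ ℕ.suc n
    cases (inj₁ X⊆W) = ℕ.m≤n⇒m≤1+n
      (omitted-bound flag Q dim-X X⊆W λ i i∈Q x∈X → in-tail i i∈Q (x∈X , X⊆W x∈X))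
    cases (inj₂ (y , y∈X , y∉W)) =
      let m , x≡1+m , dim-X∩W = hyperplane-section x W-sub
            (λ v∈X v∉W u∈X → ⊞-hyperplane W-sub (proj₁ B≐) (X⊆B v∈X) v∉W (X⊆B u∈X)) y∈X y∉W dim-X
      in ≡.subst (λ x → x ℕ.+ ∣ Q ∣ ≤ ℕ.suc n) (≡.sym x≡1+m)
           (s≤s (omitted-bound flag Q dim-X∩W proj₂ in-tail))

  flag-nonzero : ∀ {n} {b : Vector Carrier n} {V} → Flag b V → ∀ i → ¬ (b i ≈ 0#)
  flag-nonzero (step y∉W flag _) zero        y≈0 = y∉W (Zero-⊆ (flag-subspace flag) (lift y≈0))
  flag-nonzero (step _ flag _)   (Fin.suc i) y≈0 = flag-nonzero flag i y≈0

  -- Partial matchings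

  -- Division-free form of a⁻¹A: a subspace for every `a`, and equal to a⁻¹A when `a` is nonzero.
  Preimage : Subset → Carrier → Subset
  Preimage A a x = a * x ∈ A

  Preimage-subspace : ∀ {A a} → IsSubspace K A → IsSubspace K (Preimage A a)
  Preimage-subspace {a = a} A-sub = record
    { resp     = λ x≈y → resp A-sub (*-congˡ x≈y)
    ; 0-closed = Zero-⊆ A-sub (lift (zeroʳ a))
    ; +-closed = λ x∈ y∈ → resp A-sub (sym (distribˡ a _ _)) (+-closed A-sub x∈ y∈)
    ; ·-closed = λ {k} {x} k∈K x∈ → resp A-sub
        (solve 3 (λ k a x → k :* (a :* x) := a :* (k :* x)) refl k a x) (·-closed A-sub k∈K x∈)
    }

  a⁻¹A⊆Preimage : ∀ {A a} → IsSubspace K A → ¬ (a ≈ 0#) → (a ⁻¹) · A ⊆ Preimage A a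
  a⁻¹A⊆Preimage {A} {a} A-sub a≉0 (v , v∈A , x≈a⁻¹v) = resp A-sub
    (sym (trans (*-congˡ x≈a⁻¹v) (⁻¹-cancelʳ a≉0 v))) v∈A

  Preimage⊆a⁻¹A : ∀ {A a} → ¬ (a ≈ 0#) → Preimage A a ⊆ (a ⁻¹) · A
  Preimage⊆a⁻¹A {A} {a} a≉0 {x} ax∈A = a * x , ax∈A , sym (⁻¹-cancelˡ a≉0 x)

  transversal⇒matched : ∀ {n d A B} {a : Vector Carrier n} → Flag a A →
    Transversal B (λ i → Preimage A (a i)) d →
    Σ[ b ∈ Vector Carrier n ] IsBasis K B b × BasesPartiallyMatched K A B a b d
  transversal⇒matched {n} {d} {A} {B} {a} flag-a tr =
    -- A matching asks for exactly n - d indices, while a transversal may have more.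
    let Q , Q⊆P , ∣Q∣≡ = subset-of-size P (n ℕ.∸ d)
          (ℕ.m≤n+o⇒m∸n≤o n d (≡.subst (n ≤_) (ℕ.+-comm ∣ P ∣ d) size))
    in b , flag⇒basis flag , Q , ∣Q∣≡ , λ i i∈Q → in-span flag i (G-subspace i (Q⊆P i∈Q))
         (b∈G i (Q⊆P i∈Q)) (b∉G i (Q⊆P i∈Q)) (V∩B⊆G i (Q⊆P i∈Q))
    where
    open Transversal tr
    in-span : ∀ {b : Vector Carrier n} {G} → Flag b B → ∀ i → IsSubspace K G →
      (∀ j → j ≢ i → b j ∈ G) → b i ∉ G → Preimage A (a i) ∩ B ⊆ G →
      ((a i ⁻¹) · A) ∩ B ⊆ Span K (RangeOmitting b i)
    in-span {b} {G} flag i G-sub b∈G b∉G ⊆G {x} (x∈a⁻¹A , x∈B) = span i flag b∈G b∉G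
      (⊆G (a⁻¹A⊆Preimage (flag-subspace flag-a) (flag-nonzero flag-a i) x∈a⁻¹A , x∈B) , x∈B)
      where
      span : ∀ {n} {b : Vector Carrier n} i → Flag b B → (∀ j → j ≢ i → b j ∈ G) → b i ∉ G →
        G ∩ B ⊆ Span K (RangeOmitting b i)
      span {ℕ.suc n} i flag b∈G b∉G = hyperplane⊆Span i flag G-sub b∈G b∉G

  -- Obstructing fields and the two implications

  ObstructingField : ℕ → ℕ → Set (suc (c ⊔ r))
  ObstructingField ℓ n = Σ[ F ∈ Subset ] IsSubfield F × K ⊂ F × F ⊂ U ×
    ∃[ d ] HasDimension K F d × d ≤ n × (∀ j → 1 ≤ j → j ≤ ℓ ℕ.+ 1 → ¬ (d ∣ (n ℕ.+ j)))

  -- `H` is not L because h divides v, so h ≤ v ≤ n < [L:K]. It is not K because h = 1 would give v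
  -- + h ≤ n + 1, below the bound n + ℓ + 2.
  stable⇒field : ∀ {A ℓ n} → n <[L: K ] → Dim A n → StableSubspace A (n ℕ.+ ℓ ℕ.+ 2) →
    ObstructingField ℓ n
  stable⇒field {A} {ℓ} {n} n<[L:K] dim-A stable-subspace =
    H , H-subfield , (K⊆H , H⊈K) , (_ , U⊈H) , h , dim⇒ dim-H , h≤n ,
    no-multiple-between 0<h h∣v v≤n bound
    where
    open StableSubspace stable-subspace
    0<h : 0 < h
    0<h = dim-positive (1-closed H-subfield) (0≉1 ∘ sym) dim-H
    h∣v : h ∣ v
    h∣v = tower-∣ H-subfield K⊆H dim-H stable dim-V
    v≤n : v ≤ n
    v≤n = dim-mono V⊆A dim-V dim-A
    h≤n : h ≤ n
    h≤n = ℕ.≤-trans (ℕ.∣⇒≤ {{ℕ.>-nonZero 0<v}} h∣v) v≤n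
    U⊈H : ¬ (U ⊆ H)
    U⊈H U⊆H = ℕ.<⇒≱ (n<[L:K] h (dim-U dim-H (λ x → U⊆H {x} _))) h≤n
    H⊈K : ¬ (H ⊆ K)
    H⊈K H⊆K = ℕ.<⇒≱ (ℕ.+-monoʳ-< n {1} {2} ℕ.≤-refl) (begin
      n ℕ.+ 2              ≤⟨ ℕ.+-monoˡ-≤ 2 (ℕ.m≤m+n n ℓ) ⟩
      n ℕ.+ ℓ ℕ.+ 2        ≤⟨ bound ⟩
      v ℕ.+ h              ≤⟨ ℕ.+-mono-≤ v≤n (dim-mono H⊆K·1 dim-H (dim-⊞ 1∉0 dim-Zero)) ⟩
      n ℕ.+ 1              ∎)
      where
      open ℕ.≤-Reasoning
      1∉0 : 1# ∉ Zero
      1∉0 (lift 1≈0) = 0≉1 (sym 1≈0)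
      H⊆K·1 : H ⊆ Zero ⊞ 1#
      H⊆K·1 {x} x∈H = x , H⊆K x∈H ,
        lift (trans (+-congˡ (-‿cong (*-identityʳ x))) (-‿inverseʳ x))

  -- As 1 ∉ B, adjoining 1 to ⋂ⱼ a_j⁻¹A ∩ B gains one dimension while the product
  -- with ⟨a_j : j ∈ J⟩ stays inside A.
  unbounded⇒field : ∀ {A B ℓ n} {a : Vector Carrier n} → n <[L: K ] → Flag a A → Dim B n →
    1# ∉ B → ∀ J u → Dim (Common B (λ i → Preimage A (a i)) J) u → n ℕ.+ ℓ < u ℕ.+ ∣ J ∣ →
    ObstructingField ℓ n
  unbounded⇒field {A} {B} {ℓ} {n} {a} n<[L:K] flag-a dim-B 1∉B J u dim-C n+ℓ< =
    let S , S⊆A , dim-S , S-least = flag-subset flag-a J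
        s , ∣J∣≡1+s = positive ∣ J ∣ n+ℓ<
        x₀ , x₀∈S , x₀∉0 = nonzero-element (≡.subst (Dim S) ∣J∣≡1+s dim-S)
        dim-T = dim-⊞ (1∉B ∘ proj₁) dim-C
    in stable⇒field {ℓ = ℓ} n<[L:K] (_ , flag-a) (weaken
         (dyson (ℕ.suc u) ℕ.≤-refl A-sub dim-S dim-T x₀∈S (λ x₀≈0 → x₀∉0 (lift x₀≈0))
           (⊞-contains (dim-subspace dim-C)) (λ x∈S y∈T → S-least X-sub a∈X x∈S _ y∈T)))
    where
    A-sub = flag-subspace flag-a
    C = Common B (λ i → Preimage A (a i)) J
    X : Subset
    X x = ∀ y → y ∈ C ⊞ 1# → x * y ∈ A
    X-sub : IsSubspace K X
    X-sub = record
      { resp     = λ x≈z x∈X y y∈T → resp A-sub (*-congʳ x≈z) (x∈X y y∈T)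
      ; 0-closed = λ y _ → Zero-⊆ A-sub (lift (zeroˡ y))
      ; +-closed = λ x∈X z∈X y y∈T → resp A-sub (sym (distribʳ y _ _))
          (+-closed A-sub (x∈X y y∈T) (z∈X y y∈T))
      ; ·-closed = λ k∈K x∈X y y∈T → resp A-sub (sym (*-assoc _ _ y))
          (·-closed A-sub k∈K (x∈X y y∈T))
      }
    a∈X : ∀ {i} → i FinSubset.∈ J → a i ∈ X
    a∈X {i} i∈J y = ⊞-least {V = Preimage A (a i)} (Preimage-subspace A-sub)
      (λ (_ , x∈V) → x∈V i i∈J) (resp A-sub (sym (*-identityʳ (a i))) (flag-∈ flag-a i))
    -- An empty `J` would force dim C > n + ℓ although C lies in `B`; hence the span of the marked
    -- vectors has a nonzero element.
    positive : ∀ j → n ℕ.+ ℓ < u ℕ.+ j → ∃[ s ] j ≡ ℕ.suc s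
    positive (ℕ.suc s) _ = s , ≡.refl
    positive zero n+ℓ<u = contradiction
      (ℕ.≤-trans (dim-mono proj₁ dim-C dim-B) (ℕ.m≤m+n n ℓ))
      (ℕ.<⇒≱ (≡.subst (n ℕ.+ ℓ <_) (ℕ.+-identityʳ u) n+ℓ<u))
    weaken : StableSubspace A (∣ J ∣ ℕ.+ ℕ.suc u) → StableSubspace A (n ℕ.+ ℓ ℕ.+ 2)
    weaken ss = record
      { H-subfield = H-subfield ; K⊆H = K⊆H ; dim-H = dim-H ; V⊆A = V⊆A
      ; stable = stable ; dim-V = dim-V ; 0<v = 0<v ; bound = ℕ.≤-trans (begin
          n ℕ.+ ℓ ℕ.+ 2          ≡⟨ ℕ.+-comm (n ℕ.+ ℓ) 2 ⟩
          2 ℕ.+ (n ℕ.+ ℓ)        ≤⟨ s≤s n+ℓ< ⟩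
          ℕ.suc u ℕ.+ ∣ J ∣      ≡⟨ ℕ.+-comm (ℕ.suc u) ∣ J ∣ ⟩
          ∣ J ∣ ℕ.+ ℕ.suc u      ∎) bound }
      where
      open StableSubspace ss
      open ℕ.≤-Reasoning

  DeficientPair : ℕ → ℕ → Set (suc (c ⊔ r))
  DeficientPair ℓ n = Σ[ A ∈ Subset ] Σ[ B ∈ Subset ]
    IsSubspace K A × HasDimension K A n × IsSubspace K B × HasDimension K B n ×
    1# ∉ B × ∃[ δ ] IsDeficiency n K A B δ × ℓ < δ

  pair⇒field : ∀ {ℓ n} → n <[L: K ] → DeficientPair ℓ n → ObstructingField ℓ n
  pair⇒field {ℓ} {n} n<[L:K]
    (A , B , A-sub , _ , _ , dim-B , 1∉B , δ , ((δ≤n , _) , δ-least) , ℓ<δ) = cases lem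
    where
    cases : Dec (ObstructingField ℓ n) → ObstructingField ℓ n
    cases (yes field′) = field′
    -- The requirement ℓ ≤ n on a defect is inherited from ℓ < δ ≤ n.
    cases (no none) = contradiction (δ-least ℓ (ℕ.≤-trans (ℕ.<⇒≤ ℓ<δ) δ≤n , match)) (ℕ.<⇒≱ ℓ<δ)
      where
      match : (a : Vector Carrier n) → IsBasis K A a →
        Σ[ b ∈ Vector Carrier n ] IsBasis K B b × BasesPartiallyMatched K A B a b ℓ
      match a basis-a = transversal⇒matched flag-a
        (rado n ℓ (dim⇐ dim-B) (λ i → Preimage-subspace A-sub) bounded)
        where
        flag-a = basis⇒flag basis-a
        bounded : Bounded B (λ i → Preimage A (a i)) (n ℕ.+ ℓ)
        bounded J u dim-C = ℕ.≮⇒≥ λ n+ℓ< →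
          none (unbounded⇒field n<[L:K] flag-a (dim⇐ dim-B) 1∉B J u dim-C n+ℓ<)

  outside-element : ∀ {n V v} → n <[L: K ] → Dim V v → v ≤ n → ∃[ x ] x ∉ V
  outside-element {n} {V} {v} n<[L:K] dim-V v≤n with decide (∃[ x ] x ∉ V)
  ... | yes x∉V = x∉V
  ... | no none = contradiction v≤n (ℕ.<⇒≱ (n<[L:K] v (dim-U dim-V all∈V)))
    where
    all∈V : ∀ x → x ∈ V
    all∈V x with decide (x ∈ V)
    ... | yes x∈V = x∈V
    ... | no  x∉V = contradiction (x , x∉V) none

  Whole : Subset
  Whole _ = Lift (c ⊔ r) ⊤

  Whole-subspace : IsSubspace K Whole
  Whole-subspace = _

  extend-to : ∀ {n W w y} → n <[L: K ] → y ∉ W → Dim W w → w ≤ n →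
    ∃[ H ] W ⊆ H × y ∉ H × Dim H n
  extend-to {n} {W} {w} n<[L:K] y∉W dim-W w≤n =
    let H , W⊆H , _ , y∉H , dim-H = grow {X = Whole} (n ℕ.∸ w) Whole-subspace _ y∉W dim-W
          (λ {_} {v} dim-V v≤ →
            let x , x∉V = outside-element n<[L:K] dim-V (≡.subst (v ≤_) (ℕ.m+[n∸m]≡n w≤n) v≤)
            in x , _ , x∉V)
    in H , W⊆H , y∉H , ≡.subst (Dim H) (ℕ.m+[n∸m]≡n w≤n) dim-H

  -- F · V ⊆ V ⊆ A and X ⊆ F ∩ B give X ⊆ a⁻¹A ∩ B for every a ∈ V.
  deficiency-bound : ∀ {A B F V X n s m ℓ δ} → IsSubspace K A → Dim A n → X ⊆ F → X ⊆ B →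
    Stable F V → V ⊆ A → Dim V s → Dim X m → n ℕ.+ ℓ < m ℕ.+ s →
    PartiallyMatched n K A B δ → ℓ < δ
  deficiency-bound {A} {B} {F} {V} {X} {n} {s} {m} {ℓ} {δ}
    A-sub dim-A X⊆F X⊆B V-stable V⊆A dim-V dim-X n+ℓ< (δ≤n , match) =
    let a , J , flag-a , a∈V , dim-V′ = adapted-basis n (dim-subspace dim-V) V⊆A dim-A
        b , basis-b , P , ∣P∣≡ , in-span = match a (flag⇒basis flag-a)
        Q = P FinSubset.∩ J
        m+Q≤n = omitted-bound (basis⇒flag basis-b) Q dim-X X⊆B λ i i∈Q x∈X →
          let i∈P , i∈J = FinSubset.x∈p∩q⁻ P J i∈Q
          in in-span i i∈P
               ( Preimage⊆a⁻¹A {A} (flag-nonzero flag-a i)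
                   (resp A-sub (*-comm _ _) (V⊆A (V-stable (X⊆F x∈X) (a∈V i∈J))))
               , X⊆B x∈X)
    in count P J ∣P∣≡ (dim-unique _ _ dim-V dim-V′) m+Q≤n
    where
    open ℕ.≤-Reasoning
    -- As P ∪ J has at most n elements, ∣P ∩ J∣ ≥ s - δ, hence m + s ≤ n + δ. Both sides carry an
    -- extra 2n so that no truncated subtraction remains.
    count : ∀ P J → ∣ P ∣ ≡ n ℕ.∸ δ → s ≡ ∣ J ∣ → m ℕ.+ ∣ P FinSubset.∩ J ∣ ≤ n → ℓ < δ
    count P J ∣P∣≡ s≡∣J∣ m+Q≤n = ℕ.+-cancelˡ-< (n ℕ.+ n) ℓ δ (begin-strict
      n ℕ.+ n ℕ.+ ℓ                            ≡⟨ ℕ.+-assoc n n ℓ ⟩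
      n ℕ.+ (n ℕ.+ ℓ)                          <⟨ ℕ.+-monoʳ-< n n+ℓ< ⟩
      n ℕ.+ (m ℕ.+ s)                          ≡⟨ ≡.cong₂ ℕ._+_ (≡.sym (ℕ.m∸n+n≡m δ≤n)) (≡.cong (m ℕ.+_) s≡∣J∣) ⟩
      (n ℕ.∸ δ) ℕ.+ δ ℕ.+ (m ℕ.+ ∣ J ∣)        ≡⟨ ≡.cong (λ p → p ℕ.+ δ ℕ.+ (m ℕ.+ ∣ J ∣)) (≡.sym ∣P∣≡) ⟩
      ∣ P ∣ ℕ.+ δ ℕ.+ (m ℕ.+ ∣ J ∣)            ≡⟨ rearrange (∣ P ∣) δ m (∣ J ∣) ⟩
      (∣ P ∣ ℕ.+ ∣ J ∣) ℕ.+ (m ℕ.+ δ)          ≡⟨ ≡.cong (ℕ._+ (m ℕ.+ δ)) (≡.sym (∣p∪q∣+∣p∩q∣ P J)) ⟩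
      (∪ ℕ.+ ∩′) ℕ.+ (m ℕ.+ δ)                 ≡⟨ rearrange′ ∪ ∩′ m δ ⟩
      ∪ ℕ.+ (m ℕ.+ ∩′) ℕ.+ δ                   ≤⟨ ℕ.+-monoˡ-≤ δ (ℕ.+-mono-≤ (FinSubset.∣p∣≤n (P FinSubset.∪ J)) m+Q≤n) ⟩
      n ℕ.+ n ℕ.+ δ                            ∎)
      where
      ∪ = ∣ P FinSubset.∪ J ∣
      ∩′ = ∣ P FinSubset.∩ J ∣
      rearrange : ∀ p d m j → p ℕ.+ d ℕ.+ (m ℕ.+ j) ≡ (p ℕ.+ j) ℕ.+ (m ℕ.+ d)
      rearrange = solve-∀
      rearrange′ : ∀ u i m d → (u ℕ.+ i) ℕ.+ (m ℕ.+ d) ≡ u ℕ.+ (m ℕ.+ i) ℕ.+ d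
      rearrange′ = solve-∀

  -- The empty `P` works, so the set of admissible defects is inhabited and has a least element.
  defect-n : ∀ {A B n} → Dim B n → PartiallyMatched n K A B n
  defect-n {n = n} (b , flag) = ℕ.≤-refl , λ a _ → b , flag⇒basis flag , FinSubset.⊥ ,
    ≡.trans (FinSubset.∣⊥∣≡0 n) (≡.sym (ℕ.n∸n≡0 n)) , λ i i∈⊥ → ⊥-elim (FinSubset.∉⊥ i∈⊥)

  field⇒pair : ∀ {ℓ n} → n <[L: K ] → ObstructingField ℓ n → DeficientPair ℓ n
  field⇒pair n<[L:K] (F , F-fld , _ , _ , zero , dim-F , _) = contradiction
    (dim-positive (1-closed F-fld) (0≉1 ∘ sym) (dim⇐ dim-F)) (ℕ.<-irrefl ≡.refl)
  field⇒pair {ℓ} {n} n<[L:K] (F , F-fld , (K⊆F , _) , _ , ℕ.suc m , dim-F , 1+m≤n , no-multiple) =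
    conclude stable-inside avoiding-1
    where
    open ℕ.≤-Reasoning
    d = ℕ.suc m
    q = n / d
    F-sub = subfield-subspace F-fld K⊆F
    qd≤n : q ℕ.* d ≤ n
    qd≤n = begin
      q ℕ.* d                ≤⟨ ℕ.m≤n+m (q ℕ.* d) (n % d) ⟩
      n % d ℕ.+ q ℕ.* d      ≡⟨ ≡.sym (m≡m%n+[m/n]*n n d) ⟩
      n                      ∎
    n<qd+d : n < q ℕ.* d ℕ.+ d
    n<qd+d = begin-strict
      n                      ≡⟨ m≡m%n+[m/n]*n n d ⟩
      n % d ℕ.+ q ℕ.* d      <⟨ ℕ.+-monoˡ-< (q ℕ.* d) (m%n<n n d) ⟩
      d ℕ.+ q ℕ.* d          ≡⟨ ℕ.+-comm d (q ℕ.* d) ⟩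
      q ℕ.* d ℕ.+ d          ∎
    -- Here m = d - 1 is the dimension of the hyperplane of F that avoids 1; it costs the one unit
    -- by which (q + 1)d exceeds n + ℓ + 1.
    n+ℓ< : n ℕ.+ ℓ < m ℕ.+ q ℕ.* d
    n+ℓ< = ℕ.s≤s⁻¹ (begin-strict
      ℕ.suc (n ℕ.+ ℓ)        ≡⟨ ℕ.+-comm 1 (n ℕ.+ ℓ) ⟩
      n ℕ.+ ℓ ℕ.+ 1          <⟨ next-multiple-beyond q n<qd+d no-multiple ⟩
      q ℕ.* d ℕ.+ d          ≡⟨ ℕ.+-comm (q ℕ.* d) d ⟩
      ℕ.suc (m ℕ.+ q ℕ.* d)  ∎)

    stable-inside : ∃[ V ] ∃[ A ] Stable F V × Dim V (q ℕ.* d) × V ⊆ A × Dim A n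
    stable-inside = enlarge (stable-subspace q F-fld K⊆F (dim⇐ dim-F)
      (λ dim-W w< → outside-element n<[L:K] dim-W (ℕ.≤-trans (ℕ.<⇒≤ w<) qd≤n)))
      where
      enlarge : ∃[ V ] Stable F V × Dim V (q ℕ.* d) →
        ∃[ V ] ∃[ A ] Stable F V × Dim V (q ℕ.* d) × V ⊆ A × Dim A n
      enlarge (V , V-stable , dim-V) =
        let y , y∉V = outside-element n<[L:K] dim-V qd≤n
            A , V⊆A , _ , dim-A = extend-to n<[L:K] y∉V dim-V qd≤n
        in V , A , V-stable , dim-V , V⊆A , dim-A
    avoiding-1 : ∃[ X ] ∃[ B ] X ⊆ F × Dim X m × X ⊆ B × 1# ∉ B × Dim B n
    avoiding-1 = enlarge (hyperplane-avoiding Zero-subspace (Zero-⊆ F-sub)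
      (1-closed F-fld) (λ { (lift 1≈0) → 0≉1 (sym 1≈0) }) (dim⇐ dim-F))
      where
      enlarge : ∃[ X ] Zero ⊆ X × X ⊆ F × 1# ∉ X × Dim X m →
        ∃[ X ] ∃[ B ] X ⊆ F × Dim X m × X ⊆ B × 1# ∉ B × Dim B n
      enlarge (X , _ , X⊆F , 1∉X , dim-X) =
        let B , X⊆B , 1∉B , dim-B = extend-to n<[L:K] 1∉X dim-X (ℕ.<⇒≤ 1+m≤n)
        in X , B , X⊆F , dim-X , X⊆B , 1∉B , dim-B
    conclude : ∃[ V ] ∃[ A ] Stable F V × Dim V (q ℕ.* d) × V ⊆ A × Dim A n →
      ∃[ X ] ∃[ B ] X ⊆ F × Dim X m × X ⊆ B × 1# ∉ B × Dim B n → DeficientPair ℓ n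
    conclude (V , A , V-stable , dim-V , V⊆A , dim-A) (X , B , X⊆F , dim-X , X⊆B , 1∉B , dim-B) =
      let A-sub = dim-subspace dim-A
          δ , matched , δ-least = least (λ {P} → decide P) {PartiallyMatched n K A B}
            (n , defect-n {A} dim-B)
      in A , B , A-sub , dim⇒ dim-A , dim-subspace dim-B , dim⇒ dim-B , 1∉B , δ ,
         (matched , δ-least) ,
         deficiency-bound A-sub dim-A X⊆F X⊆B V-stable V⊆A dim-V dim-X n+ℓ< matched

open import Data.Nat.Base using (_+_)

theorem4p3 : ∀ {c r} → ExcludedMiddle (suc (c ⊔ r)) →
    (L : Field c r) → let open Extension L in
    (K : Subset) → IsSubfield K → K ⊂ U →
    (Σ[ F ∈ Subset ] IsSubfield F × K ⊂ F × F ⊂ U × ∃[ d ] HasDimension K F d) →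
    (ℓ n n₀ : ℕ) → Is-n₀ K n₀ → n₀ ≤ n → n <[L: K ] →
    (Σ[ A ∈ Subset ] Σ[ B ∈ Subset ]
    IsSubspace K A × HasDimension K A n ×
    IsSubspace K B × HasDimension K B n ×
    Field.1# L ∉ B × ∃[ δ ] IsDeficiency n K A B δ × ℓ < δ)
    ⇔
    (Σ[ F ∈ Subset ] IsSubfield F × K ⊂ F × F ⊂ U ×
    ∃[ d ] HasDimension K F d × d ≤ n ×
    (∀ j → 1 ≤ j → j ≤ ℓ + 1 → ¬ (d ∣ (n + j))))
theorem4p3 lem L K K-subfield _ _ _ _ _ _ _ n<[L:K] = mk⇔ (pair⇒field n<[L:K]) (field⇒pair n<[L:K])
  where open Matching lem L K K-subfield
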